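{- Let $n$ be odd and let $X=(X_{ij})$ be the $n\times n$ matrix of indeterminates. Then $AT(n)$ is the coefficient of $(-1)^{\frac{n(n-1)}{2}}\prod_{i=1}^n\prod_{j=1}^nX_{ij}$ in the polynomial $\frac{1}{n!(n-1)!}\,\mathrm{per}(X)\det(X)^{n-1}$; that is, the coefficient of the monomial $\prod_{i=1}^n\prod_{j=1}^nX_{ij}$ in $\frac{1}{n!(n-1)!}\mathrm{per}(X)\det(X)^{n-1}$ equals $(-1)^{\frac{n(n-1)}{2}}AT(n)$.
   Context: $\mathrm{per}$ denotes the permanent. A Latin square of order $n$ is an $n\times n$ array with entries in $[n]$ in which each number appears exactly once in each row and each column. Viewing rows and columns as permutations of $[n]$, the sign of a Latin square is the product of the signs of all its rows and all its columns; it is even if its sign is $1$ and odd if $-1$. A Latin square is normalized if its first row is the identity permutation and unipotent if all entries on its main diagonal are equal. $AT(n)=U_n^{\mathrm{E}}-U_n^{\mathrm{O}}$, where $U_n^{\mathrm{E}}$ ($U_n^{\mathrm{O}}$) is the number of normalized unipotent even (odd) Latin squares of order $n$. -}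

module Defs where

open import Data.Nat as ℕ using (ℕ; zero; suc; _∸_; _<ᵇ_)
open import Data.Integer as ℤ using (ℤ; +_; 0ℤ; 1ℤ; -1ℤ)
open import Data.Fin using (Fin; zero; suc; toℕ; _≟_)
open import Data.Fin.Properties using (all?)
open import Data.List using (List; []; _∷_; [_]; map; concatMap; filter; length; foldr; upTo; allFin)
open import Data.Vec.Functional as VF using (Vector)
open import Data.Bool using (if_then_else_; _∧_)
open import Data.Product using (_×_)
open import Data.Unit using (⊤; tt)
open import Function using (_∘_)
open import Relation.Nullary using (Dec; yes; no; does)
open import Relation.Nullary.Decidable using (_×-dec_; _→-dec_)
open import Relation.Binary.PropositionalEquality using (_≡_)

boxes : ∀ {A : Set} (k : ℕ) → (Fin k → List A) → List (Fin k → A)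
boxes zero    L = [ (λ ()) ]
boxes (suc k) L = concatMap (λ a → map (a VF.∷_) (boxes k (L ∘ suc))) (L zero)

allFuns : ∀ {A : Set} (k : ℕ) → List A → List (Fin k → A)
allFuns k xs = boxes k (λ _ → xs)

IsPerm : ∀ {n} → (Fin n → Fin n) → Set
IsPerm f = ∀ i j → f i ≡ f j → i ≡ j

isPerm? : ∀ {n} (f : Fin n → Fin n) → Dec (IsPerm f)
isPerm? f = all? (λ i → all? (λ j → (f i ≟ f j) →-dec (i ≟ j)))

perms : (n : ℕ) → List (Fin n → Fin n)
perms n = filter isPerm? (allFuns n (allFin n))

sumℕ : List ℕ → ℕ
sumℕ = foldr ℕ._+_ 0

inversions : ∀ {n} → (Fin n → Fin n) → ℕ
inversions {n} f =
  sumℕ (map (λ i → sumℕ (map (λ j →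
    if (toℕ i <ᵇ toℕ j) ∧ (toℕ (f j) <ᵇ toℕ (f i)) then 1 else 0)
    (allFin n))) (allFin n))

sgn : ∀ {n} → (Fin n → Fin n) → ℤ
sgn f = -1ℤ ℤ.^ inversions f

Square : ℕ → Set
Square n = Fin n → Fin n → Fin n

row : ∀ {n} → Square n → Fin n → (Fin n → Fin n)
row L i = λ j → L i j

col : ∀ {n} → Square n → Fin n → (Fin n → Fin n)
col L j = λ i → L i j

-- each number appears exactly once in each row and each column
-- (for maps Fin n → Fin n, injective = bijective)
IsLatin : ∀ {n} → Square n → Set
IsLatin L = (∀ i → IsPerm (row L i)) × (∀ j → IsPerm (col L j))

isLatin? : ∀ {n} (L : Square n) → Dec (IsLatin L)
isLatin? L = all? (λ i → isPerm? (row L i)) ×-dec all? (λ j → isPerm? (col L j))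

IsNormalized : ∀ {n} → Square n → Set
IsNormalized {zero}  L = ⊤
IsNormalized {suc n} L = ∀ j → L zero j ≡ j

isNormalized? : ∀ {n} (L : Square n) → Dec (IsNormalized L)
isNormalized? {zero}  L = yes tt
isNormalized? {suc n} L = all? (λ j → L zero j ≟ j)

IsUnipotent : ∀ {n} → Square n → Set
IsUnipotent L = ∀ i j → L i i ≡ L j j

isUnipotent? : ∀ {n} (L : Square n) → Dec (IsUnipotent L)
isUnipotent? L = all? (λ i → all? (λ j → L i i ≟ L j j))

prodℤ : List ℤ → ℤ
prodℤ = foldr ℤ._*_ 1ℤ

sgnSquare : ∀ {n} → Square n → ℤ
sgnSquare {n} L =
  prodℤ (map (λ i → sgn (row L i)) (allFin n)) ℤ.*
  prodℤ (map (λ j → sgn (col L j)) (allFin n))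

NormUnipLatin : ∀ {n} → Square n → Set
NormUnipLatin L = IsLatin L × IsNormalized L × IsUnipotent L

normUnipLatin? : ∀ {n} (L : Square n) → Dec (NormUnipLatin L)
normUnipLatin? L = isLatin? L ×-dec isNormalized? L ×-dec isUnipotent? L

allSquares : (n : ℕ) → List (Square n)
allSquares n = allFuns n (allFuns n (allFin n))

UE : ℕ → ℕ
UE n = length (filter (λ L → normUnipLatin? L ×-dec (sgnSquare L ℤ.≟ 1ℤ)) (allSquares n))

UO : ℕ → ℕ
UO n = length (filter (λ L → normUnipLatin? L ×-dec (sgnSquare L ℤ.≟ -1ℤ)) (allSquares n))

AT : ℕ → ℤ
AT n = + UE n ℤ.- + UO n

-- Polynomials over ℤ in the n² indeterminates X_ij (i, j ∈ Fin n).
-- A monomial is an exponent matrix; a polynomial is its coefficient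
-- function. (Only finitely supported polynomials are ever built.)

Monomial : ℕ → Set
Monomial n = Fin n → Fin n → ℕ

Poly : ℕ → Set
Poly n = Monomial n → ℤ

_≟M_ : ∀ {n} (a b : Monomial n) → Dec (∀ i j → a i j ≡ b i j)
a ≟M b = all? (λ i → all? (λ j → a i j ℕ.≟ b i j))

zeroMon : ∀ {n} → Monomial n
zeroMon i j = 0

varMon : ∀ {n} → Fin n → Fin n → Monomial n
varMon k l i j = if does (k ≟ i) ∧ does (l ≟ j) then 1 else 0

allOnes : ∀ {n} → Monomial n
allOnes i j = 1

coeff : ∀ {n} → Poly n → Monomial n → ℤ
coeff p m = p m

0P : ∀ {n} → Poly n
0P m = 0ℤ

constP : ∀ {n} → ℤ → Poly n
constP c m = if does (m ≟M zeroMon) then c else 0ℤ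

1P : ∀ {n} → Poly n
1P = constP 1ℤ

X : ∀ {n} → Fin n → Fin n → Poly n
X k l m = if does (m ≟M varMon k l) then 1ℤ else 0ℤ

_+P_ : ∀ {n} → Poly n → Poly n → Poly n
(p +P q) m = p m ℤ.+ q m

sumℤ : List ℤ → ℤ
sumℤ = foldr ℤ._+_ 0ℤ

divisors : ∀ {n} → Monomial n → List (Monomial n)
divisors {n} m = boxes n (λ i → boxes n (λ j → upTo (suc (m i j))))

_*P_ : ∀ {n} → Poly n → Poly n → Poly n
(p *P q) m = sumℤ (map (λ a → p a ℤ.* q (λ i j → m i j ∸ a i j)) (divisors m))

_^P_ : ∀ {n} → Poly n → ℕ → Poly n
p ^P zero    = 1P
p ^P (suc k) = p *P (p ^P k)

sumP : ∀ {n} → List (Poly n) → Poly n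
sumP = foldr _+P_ 0P

prodP : ∀ {n} → List (Poly n) → Poly n
prodP = foldr _*P_ 1P

per : (n : ℕ) → Poly n
per n = sumP (map (λ σ → prodP (map (λ i → X i (σ i)) (allFin n))) (perms n))

det : (n : ℕ) → Poly n
det n = sumP (map (λ σ → constP (sgn σ) *P prodP (map (λ i → X i (σ i)) (allFin n))) (perms n))

{-# OPTIONS --safe #-}

-- Expanding the product, the coefficient is the sum of sgn σ₁ ⋯ sgn σₙ₋₁ over all
-- tuples (σ₀, …, σₙ₋₁) of permutations whose graphs partition [n] × [n], that is, over
-- all Latin squares R with rows σₖ.  Replacing every σₖ by σ₀⁻¹σₖ leaves the weight
-- unchanged, as n − 1 is even, and makes the first row the identity (factor n!);
-- permuting the remaining rows makes the first column the identity (factor (n − 1)!).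
-- The conjugate L, with L i j = k iff σₖ i = j, is then normalized and unipotent, and
-- the weight is the product of its symbol signs.  This product equals
-- (−1)^(n choose 2) sgn L: writing N for the product of the signs of
-- (c − c′)(L r c − L r′ c′) over pairs of cells with no common row, column or symbol,
-- grouping the pairs by {r, r′} gives (column sign)(symbol sign) N = 1, and grouping
-- them by {c, c′} gives (row sign) N = (−1)^(n choose 2).

module Submission where

open import Defs
open import Data.Nat using (ℕ; zero; suc; _∸_; _*_; _/_; _%_; _!; _<ᵇ_)
import Data.Nat as ℕ
import Data.Nat.Divisibility as ℕ
import Data.Nat.DivMod as ℕ
import Data.Nat.Properties as ℕ
open import Data.Nat.Solver using () renaming (module +-*-Solver to ℕ-Solver)
open import Data.Integer using (ℤ; +_; 0ℤ; 1ℤ; -1ℤ; _^_) renaming (_*_ to _*ℤ_; _+_ to _+ℤ_; _-_ to _-ℤ_)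
import Data.Integer as ℤ
import Data.Integer.Properties as ℤ
open import Data.Integer.Solver using (module +-*-Solver)
open import Data.Fin using (Fin; zero; suc; _≟_; punchOut; toℕ)
open import Data.Fin.Permutation using (permutation)
open import Data.Fin.Permutation.Components using (transpose; transpose-inverse)
open import Data.Fin.Properties using (all?; any?; ∀-cons; injective⇒≤; punchOut-injective; suc-injective)
open import Data.List using (List; []; _∷_; _++_; map; concatMap; filter; foldr; length; tabulate; allFin; upTo)
open import Data.List.Properties using (map-cong; map-tabulate; map-upTo)
import Data.Vec.Functional as VF
open import Data.Bool using (Bool; true; false; not; _∧_; if_then_else_)
open import Data.Product using (_×_; _,_; proj₁; proj₂; ∃)
open import Data.Sum using (_⊎_; inj₁; inj₂)
open import Data.Unit using (⊤; tt)
open import Function using (_∘_)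
open import Relation.Binary.Structures using (IsEquivalence)
open import Relation.Nullary using (Dec; yes; no; does; ¬_; contradiction)
open import Relation.Nullary.Decidable using (_×-dec_; dec-true; dec-false)
open import Relation.Binary.PropositionalEquality using (_≡_; _≢_; refl; sym; trans; cong; cong₂; module ≡-Reasoning)
import Relation.Binary.PropositionalEquality.Properties as ≡
open import Algebra.Properties.CommutativeMonoid.Sum ℤ.*-1-commutativeMonoid
  using ()
  renaming ( sum to ∏; sum-cong-≗ to ∏-cong; ∑-distrib-+ to ∏-distrib-*; ∑-comm to ∏-comm
           ; sum-permute to ∏-permute; sum-replicate-zero to ∏-one)

open ≡-Reasoning
open +-*-Solver using (solve; _:*_; _:+_; _:-_; _:=_)

-- For r < r′ and c < c′ the two diagonals of a 2 × 2 subarray each give one pair of cells, so N is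
-- indexed by row pairs and column pairs alike, and its two groupings differ by an exchange of
-- products. For fixed rows, the comparisons of columns and those of symbols each multiply to
-- (-1)^(n choose 2) over all ordered pairs of columns, which is why the total is 1. For fixed c <
-- c′ the column comparison is constantly 1, so a single (-1)^(n choose 2) remains; over all column
-- pairs the exponent is squared, which keeps its parity. Eliminating N then expresses the symbol
-- sign.
--
-- The weight omits σ₀ because that row comes from the permanent; once the row is the identity, with
-- sign 1, the weight is the product of all row signs.
--
-- The formal obstacle is that permutations and squares are functions, listed only up to pointwise
-- equality. Hence conditions become indicators, every sum runs over a full list of functions, and a
-- bijection is used by counting the pairs in its graph in two ways, never by rearranging lists.

private
  variable
    A B I J : Set
    P Q : Set
    n : ℕ

-- Finite sums

∑ : List A → (A → ℤ) → ℤ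
∑ xs f = sumℤ (map f xs)

∑-cong : ∀ {f g : A → ℤ} xs → (∀ x → f x ≡ g x) → ∑ xs f ≡ ∑ xs g
∑-cong xs eq = cong sumℤ (map-cong eq xs)

∑-zero : ∀ (xs : List A) → ∑ xs (λ _ → 0ℤ) ≡ 0ℤ
∑-zero []       = refl
∑-zero (x ∷ xs) = trans (ℤ.+-identityˡ _) (∑-zero xs)

∑-distrib-+ : ∀ (xs : List A) f g → ∑ xs (λ x → f x +ℤ g x) ≡ ∑ xs f +ℤ ∑ xs g
∑-distrib-+ []       f g = refl
∑-distrib-+ (x ∷ xs) f g = begin
  (f x +ℤ g x) +ℤ ∑ xs (λ y → f y +ℤ g y)  ≡⟨ cong ((f x +ℤ g x) +ℤ_) (∑-distrib-+ xs f g) ⟩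
  (f x +ℤ g x) +ℤ (∑ xs f +ℤ ∑ xs g)       ≡⟨ solve 4 (λ a b c d → (a :+ b) :+ (c :+ d) := (a :+ c) :+ (b :+ d)) refl (f x) (g x) (∑ xs f) (∑ xs g) ⟩
  (f x +ℤ ∑ xs f) +ℤ (g x +ℤ ∑ xs g)       ∎

∑-distribˡ-* : ∀ (xs : List A) c f → c *ℤ ∑ xs f ≡ ∑ xs (λ x → c *ℤ f x)
∑-distribˡ-* []       c f = ℤ.*-zeroʳ c
∑-distribˡ-* (x ∷ xs) c f = trans (ℤ.*-distribˡ-+ c (f x) (∑ xs f)) (cong (c *ℤ f x +ℤ_) (∑-distribˡ-* xs c f))

∑-distribʳ-* : ∀ (xs : List A) c f → ∑ xs f *ℤ c ≡ ∑ xs (λ x → f x *ℤ c)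
∑-distribʳ-* xs c f = begin
  ∑ xs f *ℤ c            ≡⟨ ℤ.*-comm (∑ xs f) c ⟩
  c *ℤ ∑ xs f            ≡⟨ ∑-distribˡ-* xs c f ⟩
  ∑ xs (λ x → c *ℤ f x)  ≡⟨ ∑-cong xs (λ x → ℤ.*-comm c (f x)) ⟩
  ∑ xs (λ x → f x *ℤ c)  ∎

∑-comm : ∀ (xs : List A) (ys : List B) (f : A → B → ℤ) →
  ∑ xs (λ x → ∑ ys (f x)) ≡ ∑ ys (λ y → ∑ xs (λ x → f x y))
∑-comm []       ys f = sym (∑-zero ys)
∑-comm (x ∷ xs) ys f = trans
  (cong (∑ ys (f x) +ℤ_) (∑-comm xs ys f))
  (sym (∑-distrib-+ ys (f x) (λ y → ∑ xs (λ x′ → f x′ y))))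

∑-++ : ∀ (xs ys : List A) f → ∑ (xs ++ ys) f ≡ ∑ xs f +ℤ ∑ ys f
∑-++ []       ys f = sym (ℤ.+-identityˡ _)
∑-++ (x ∷ xs) ys f = trans (cong (f x +ℤ_) (∑-++ xs ys f)) (sym (ℤ.+-assoc (f x) (∑ xs f) (∑ ys f)))

∑-map : ∀ (h : A → B) xs f → ∑ (map h xs) f ≡ ∑ xs (f ∘ h)
∑-map h []       f = refl
∑-map h (x ∷ xs) f = cong (f (h x) +ℤ_) (∑-map h xs f)

∑-concatMap : ∀ (h : A → List B) xs f → ∑ (concatMap h xs) f ≡ ∑ xs (λ x → ∑ (h x) f)
∑-concatMap h []       f = refl
∑-concatMap h (x ∷ xs) f = trans (∑-++ (h x) (concatMap h xs) f) (cong (∑ (h x) f +ℤ_) (∑-concatMap h xs f))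

∑-boxes-suc : ∀ k (L : Fin (suc k) → List A) F →
  ∑ (boxes (suc k) L) F ≡ ∑ (L zero) (λ a → ∑ (boxes k (L ∘ suc)) (λ f → F (a VF.∷ f)))
∑-boxes-suc k L F = trans
  (∑-concatMap (λ a → map (a VF.∷_) (boxes k (L ∘ suc))) (L zero) F)
  (∑-cong (L zero) (λ a → ∑-map (a VF.∷_) (boxes k (L ∘ suc)) F))

-- Indicators

⟦_⟧ : Dec P → ℤ
⟦ P? ⟧ = if does P? then 1ℤ else 0ℤ

⟦⟧-true : (P? : Dec P) → P → ⟦ P? ⟧ ≡ 1ℤ
⟦⟧-true (yes _) p = refl
⟦⟧-true (no ¬p) p = contradiction p ¬p

⟦⟧-false : (P? : Dec P) → ¬ P → ⟦ P? ⟧ ≡ 0ℤ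
⟦⟧-false (yes p) ¬p = contradiction p ¬p
⟦⟧-false (no _)  ¬p = refl

⟦⟧-cong : (P? : Dec P) (Q? : Dec Q) → (P → Q) → (Q → P) → ⟦ P? ⟧ ≡ ⟦ Q? ⟧
⟦⟧-cong (yes p) Q? to from = sym (⟦⟧-true Q? (to p))
⟦⟧-cong (no ¬p) Q? to from = sym (⟦⟧-false Q? (¬p ∘ from))

⟦⟧-× : (P? : Dec P) (Q? : Dec Q) → ⟦ P? ×-dec Q? ⟧ ≡ ⟦ P? ⟧ *ℤ ⟦ Q? ⟧
⟦⟧-× (yes _) (yes _) = refl
⟦⟧-× (yes _) (no _)  = refl
⟦⟧-× (no _)  Q?      = refl

⟦⟧*-cong : (P? : Dec P) {x y : ℤ} → (P → x ≡ y) → ⟦ P? ⟧ *ℤ x ≡ ⟦ P? ⟧ *ℤ y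
⟦⟧*-cong (yes p) eq = cong (1ℤ *ℤ_) (eq p)
⟦⟧*-cong (no _)  eq = refl

⟦⟧-all-suc : ∀ {k} {P : Fin (suc k) → Set} (P? : ∀ i → Dec (P i)) →
  ⟦ all? P? ⟧ ≡ ⟦ P? zero ⟧ *ℤ ⟦ all? (P? ∘ suc) ⟧
⟦⟧-all-suc P? = trans
  (⟦⟧-cong (all? P?) (P? zero ×-dec all? (P? ∘ suc)) (λ h → h zero , h ∘ suc) (λ (h₀ , h) → ∀-cons h₀ h))
  (⟦⟧-× (P? zero) (all? (P? ∘ suc)))

∑-filter : ∀ {P : A → Set} (P? : ∀ x → Dec (P x)) xs f →
  ∑ (filter P? xs) f ≡ ∑ xs (λ x → ⟦ P? x ⟧ *ℤ f x)
∑-filter P? []       f = refl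
∑-filter P? (x ∷ xs) f with P? x
... | yes _ = cong₂ _+ℤ_ (sym (ℤ.*-identityˡ (f x))) (∑-filter P? xs f)
... | no _  = trans (∑-filter P? xs f) (sym (ℤ.+-identityˡ _))

-- M i is the condition for a i to be listed in L i, where it then occurs only once.
∑-boxes-count : ∀ {_≈_ : A → A → Set} (_≈?_ : ∀ x y → Dec (x ≈ y)) k (L : Fin k → List A) (a : Fin k → A)
  {M : Fin k → Set} (M? : ∀ i → Dec (M i)) →
  (∀ i → ∑ (L i) (λ x → ⟦ x ≈? a i ⟧) ≡ ⟦ M? i ⟧) →
  ∑ (boxes k L) (λ f → ⟦ all? (λ i → f i ≈? a i) ⟧) ≡ ⟦ all? M? ⟧
∑-boxes-count _≈?_ zero    L a M? count = refl
∑-boxes-count _≈?_ (suc k) L a M? count = begin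
  ∑ (boxes (suc k) L) (λ f → ⟦ all? (λ i → f i ≈? a i) ⟧)
    ≡⟨ ∑-boxes-suc k L _ ⟩
  ∑ (L zero) (λ x → ∑ rest (λ f → ⟦ all? (λ i → (x VF.∷ f) i ≈? a i) ⟧))
    ≡⟨ ∑-cong (L zero) (λ x → ∑-cong rest (λ f → ⟦⟧-all-suc (λ i → (x VF.∷ f) i ≈? a i))) ⟩
  ∑ (L zero) (λ x → ∑ rest (λ f → ⟦ x ≈? a zero ⟧ *ℤ ⟦ all? (λ i → f i ≈? a (suc i)) ⟧))
    ≡⟨ ∑-cong (L zero) (λ x → sym (∑-distribˡ-* rest ⟦ x ≈? a zero ⟧ _)) ⟩
  ∑ (L zero) (λ x → ⟦ x ≈? a zero ⟧ *ℤ ∑ rest (λ f → ⟦ all? (λ i → f i ≈? a (suc i)) ⟧))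
    ≡⟨ sym (∑-distribʳ-* (L zero) _ _) ⟩
  ∑ (L zero) (λ x → ⟦ x ≈? a zero ⟧) *ℤ ∑ rest (λ f → ⟦ all? (λ i → f i ≈? a (suc i)) ⟧)
    ≡⟨ cong₂ _*ℤ_ (count zero) (∑-boxes-count _≈?_ k (L ∘ suc) (a ∘ suc) (M? ∘ suc) (count ∘ suc)) ⟩
  ⟦ M? zero ⟧ *ℤ ⟦ all? (M? ∘ suc) ⟧
    ≡⟨ sym (⟦⟧-all-suc M?) ⟩
  ⟦ all? M? ⟧ ∎
  where rest = boxes k (L ∘ suc)

-- Turns tuples of permutations into arbitrary squares with an indicator, so that all later sums
-- share the index list `allSquares`.
∑-allFuns-filter : ∀ {P : A → Set} (P? : ∀ x → Dec (P x)) k xs F →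
  ∑ (allFuns k (filter P? xs)) F ≡ ∑ (allFuns k xs) (λ f → ⟦ all? (λ i → P? (f i)) ⟧ *ℤ F f)
∑-allFuns-filter P? zero    xs F = cong (_+ℤ 0ℤ) (sym (ℤ.*-identityˡ (F _)))
∑-allFuns-filter P? (suc k) xs F = begin
  ∑ (allFuns (suc k) (filter P? xs)) F
    ≡⟨ ∑-boxes-suc k (λ _ → filter P? xs) F ⟩
  ∑ (filter P? xs) (λ a → ∑ (allFuns k (filter P? xs)) (λ f → F (a VF.∷ f)))
    ≡⟨ ∑-filter P? xs _ ⟩
  ∑ xs (λ a → ⟦ P? a ⟧ *ℤ ∑ (allFuns k (filter P? xs)) (λ f → F (a VF.∷ f)))
    ≡⟨ ∑-cong xs (λ a → cong (⟦ P? a ⟧ *ℤ_) (∑-allFuns-filter P? k xs _)) ⟩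
  ∑ xs (λ a → ⟦ P? a ⟧ *ℤ ∑ (allFuns k xs) (λ f → ⟦ all? (λ i → P? (f i)) ⟧ *ℤ F (a VF.∷ f)))
    ≡⟨ ∑-cong xs (λ a → trans (∑-distribˡ-* (allFuns k xs) ⟦ P? a ⟧ _) (∑-cong (allFuns k xs) (λ f → step a f))) ⟩
  ∑ xs (λ a → ∑ (allFuns k xs) (λ f → ⟦ all? (λ i → P? ((a VF.∷ f) i)) ⟧ *ℤ F (a VF.∷ f)))
    ≡⟨ sym (∑-boxes-suc k (λ _ → xs) (λ f → ⟦ all? (λ i → P? (f i)) ⟧ *ℤ F f)) ⟩
  ∑ (allFuns (suc k) xs) (λ f → ⟦ all? (λ i → P? (f i)) ⟧ *ℤ F f) ∎
  where
  step : ∀ a f → ⟦ P? a ⟧ *ℤ (⟦ all? (λ i → P? (f i)) ⟧ *ℤ F (a VF.∷ f)) ≡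
                 ⟦ all? (λ i → P? ((a VF.∷ f) i)) ⟧ *ℤ F (a VF.∷ f)
  step a f = trans (sym (ℤ.*-assoc ⟦ P? a ⟧ _ _))
    (cong (_*ℤ F (a VF.∷ f)) (sym (⟦⟧-all-suc (λ i → P? ((a VF.∷ f) i)))))

-- Enumerated setoids

-- Functions are compared pointwise, so "listed exactly once" can only mean once up to `_≈_`;
-- `count-one` states this as an indicator sum, ready to be inserted as a factor 1.
record Enumerated (A : Set) : Set₁ where
  field
    _≈_           : A → A → Set
    isEquivalence : IsEquivalence _≈_
    _≈?_          : ∀ x y → Dec (x ≈ y)
    elements      : List A
    count-one     : ∀ a → ∑ elements (λ x → ⟦ x ≈? a ⟧) ≡ 1ℤ
  open IsEquivalence isEquivalence public
    renaming (refl to ≈-refl; sym to ≈-sym; trans to ≈-trans)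

∑-allFin-suc : ∀ n (f : Fin (suc n) → ℤ) → ∑ (allFin (suc n)) f ≡ f zero +ℤ ∑ (allFin n) (f ∘ suc)
∑-allFin-suc n f = cong (λ xs → f zero +ℤ sumℤ xs)
  (trans (map-tabulate suc f) (sym (map-tabulate (λ i → i) (f ∘ suc))))

∑-allFin-count : ∀ n (a : Fin n) → ∑ (allFin n) (λ x → ⟦ x ≟ a ⟧) ≡ 1ℤ
∑-allFin-count (suc n) zero = trans (∑-allFin-suc n (λ x → ⟦ x ≟ zero ⟧))
  (cong (1ℤ +ℤ_) (trans (∑-cong (allFin n) (λ x → ⟦⟧-false (suc x ≟ zero) (λ ()))) (∑-zero (allFin n))))
∑-allFin-count (suc n) (suc a) = trans (∑-allFin-suc n (λ x → ⟦ x ≟ suc a ⟧)) (trans (ℤ.+-identityˡ _)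
  (trans (∑-cong (allFin n) (λ x → ⟦⟧-cong (suc x ≟ suc a) (x ≟ a) (λ { refl → refl }) (cong suc))) (∑-allFin-count n a)))

finEnum : ∀ n → Enumerated (Fin n)
finEnum n = record
  { _≈_ = _≡_ ; isEquivalence = ≡.isEquivalence ; _≈?_ = _≟_
  ; elements = allFin n ; count-one = ∑-allFin-count n }

funEnum : ∀ k → Enumerated A → Enumerated (Fin k → A)
funEnum k E = record
  { _≈_ = λ f g → ∀ i → f i ≈ g i
  ; isEquivalence = record
    { refl = λ i → ≈-refl ; sym = λ e i → ≈-sym (e i) ; trans = λ e e′ i → ≈-trans (e i) (e′ i) }
  ; _≈?_ = λ f g → all? (λ i → f i ≈? g i)
  ; elements = allFuns k elements
  ; count-one = λ a → trans
      (∑-boxes-count _≈?_ k (λ _ → elements) a (λ _ → yes tt) (λ i → count-one (a i)))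
      (⟦⟧-true (all? {k} (λ _ → yes tt)) (λ _ → tt)) }
  where open Enumerated E

module _ (EB : Enumerated B) where
  open Enumerated EB

  ∑-fibres : ∀ (xs : List A) (φ : A → B) F →
    ∑ xs F ≡ ∑ elements (λ b → ∑ xs (λ a → ⟦ b ≈? φ a ⟧ *ℤ F a))
  ∑-fibres xs φ F = begin
    ∑ xs F                                                    ≡⟨ ∑-cong xs (λ a → sym (ℤ.*-identityˡ (F a))) ⟩
    ∑ xs (λ a → 1ℤ *ℤ F a)                                    ≡⟨ ∑-cong xs (λ a → cong (_*ℤ F a) (sym (count-one (φ a)))) ⟩
    ∑ xs (λ a → ∑ elements (λ b → ⟦ b ≈? φ a ⟧) *ℤ F a)       ≡⟨ ∑-cong xs (λ a → ∑-distribʳ-* elements (F a) _) ⟩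
    ∑ xs (λ a → ∑ elements (λ b → ⟦ b ≈? φ a ⟧ *ℤ F a))       ≡⟨ ∑-comm xs elements _ ⟩
    ∑ elements (λ b → ∑ xs (λ a → ⟦ b ≈? φ a ⟧ *ℤ F a))       ∎

module _ (EA : Enumerated A) (EB : Enumerated B) where
  private
    module A = Enumerated EA
    module B = Enumerated EB

  -- Both sides are the same double sum over pairs (a, b) in the common graph of `φ` and `ψ`.
  -- Quantifying over every b with `b ≈ φ a`, instead of evaluating at `φ a`, builds compatibility
  -- with `≈` into the hypotheses.
  ∑-reindex : ∀ {P : A → Set} {Q : B → Set} (P? : ∀ a → Dec (P a)) (Q? : ∀ b → Dec (Q b))
    (F : A → ℤ) (G : B → ℤ) (φ : A → B) (ψ : B → A) →
    (∀ a b → P a → b B.≈ φ a → Q b × a A.≈ ψ b × F a ≡ G b) →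
    (∀ a b → Q b → a A.≈ ψ b → P a × b B.≈ φ a) →
    ∑ A.elements (λ a → ⟦ P? a ⟧ *ℤ F a) ≡ ∑ B.elements (λ b → ⟦ Q? b ⟧ *ℤ G b)
  ∑-reindex P? Q? F G φ ψ to from = begin
    ∑ A.elements (λ a → ⟦ P? a ⟧ *ℤ F a)
      ≡⟨ ∑-fibres EB A.elements φ _ ⟩
    ∑ B.elements (λ b → ∑ A.elements (λ a → ⟦ b B.≈? φ a ⟧ *ℤ (⟦ P? a ⟧ *ℤ F a)))
      ≡⟨ ∑-cong B.elements (λ b → ∑-cong A.elements (λ a → match a b)) ⟩
    ∑ B.elements (λ b → ∑ A.elements (λ a → ⟦ a A.≈? ψ b ⟧ *ℤ (⟦ Q? b ⟧ *ℤ G b)))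
      ≡⟨ sym (∑-comm A.elements B.elements _) ⟩
    ∑ A.elements (λ a → ∑ B.elements (λ b → ⟦ a A.≈? ψ b ⟧ *ℤ (⟦ Q? b ⟧ *ℤ G b)))
      ≡⟨ sym (∑-fibres EA B.elements ψ _) ⟩
    ∑ B.elements (λ b → ⟦ Q? b ⟧ *ℤ G b) ∎
    where
    match : ∀ a b → ⟦ b B.≈? φ a ⟧ *ℤ (⟦ P? a ⟧ *ℤ F a) ≡ ⟦ a A.≈? ψ b ⟧ *ℤ (⟦ Q? b ⟧ *ℤ G b)
    match a b = begin
      ⟦ b B.≈? φ a ⟧ *ℤ (⟦ P? a ⟧ *ℤ F a)  ≡⟨ sym (ℤ.*-assoc ⟦ b B.≈? φ a ⟧ _ _) ⟩
      ⟦ b B.≈? φ a ⟧ *ℤ ⟦ P? a ⟧ *ℤ F a    ≡⟨ cong (_*ℤ F a) (sym (⟦⟧-× (b B.≈? φ a) (P? a))) ⟩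
      ⟦ (b B.≈? φ a) ×-dec P? a ⟧ *ℤ F a   ≡⟨ ⟦⟧*-cong ((b B.≈? φ a) ×-dec P? a) (λ (e , p) → proj₂ (proj₂ (to a b p e))) ⟩
      ⟦ (b B.≈? φ a) ×-dec P? a ⟧ *ℤ G b   ≡⟨ cong (_*ℤ G b) (⟦⟧-cong ((b B.≈? φ a) ×-dec P? a) ((a A.≈? ψ b) ×-dec Q? b)
                                                 (λ (e , p) → let (q , e′ , _) = to a b p e in e′ , q)
                                                 (λ (e , q) → let (p , e′) = from a b q e in e′ , p)) ⟩
      ⟦ (a A.≈? ψ b) ×-dec Q? b ⟧ *ℤ G b   ≡⟨ cong (_*ℤ G b) (⟦⟧-× (a A.≈? ψ b) (Q? b)) ⟩
      ⟦ a A.≈? ψ b ⟧ *ℤ ⟦ Q? b ⟧ *ℤ G b    ≡⟨ ℤ.*-assoc ⟦ a A.≈? ψ b ⟧ _ _ ⟩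
      ⟦ a A.≈? ψ b ⟧ *ℤ (⟦ Q? b ⟧ *ℤ G b)  ∎

-- Injective self-maps of Fin n

-- Pigeonhole: if j were missed, punching it out would inject `Fin (suc n)` into `Fin n`.
injective⇒surjective : {f : Fin n → Fin n} → IsPerm f → ∀ j → ∃ λ i → f i ≡ j
injective⇒surjective {suc n} {f} inj j with any? (λ i → f i ≟ j)
... | yes hit = hit
... | no miss = contradiction
  (injective⇒≤ {f = λ i → punchOut {i = j} {j = f i} (λ e → miss (i , sym e))}
    (λ {i} {i′} e → inj i i′ (punchOut-injective (λ e → miss (i , sym e)) (λ e → miss (i′ , sym e)) e)))
  ℕ.1+n≰n

-- A section of f is injective, hence surjective, so every index is a value of the section, and on
-- such values f can be undone.
surjective⇒injective : {f : Fin n → Fin n} → (∀ j → ∃ λ i → f i ≡ j) → IsPerm f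
surjective⇒injective {f = f} surj i i′ fi≡fi′
  with injective⇒surjective section-injective i | injective⇒surjective section-injective i′
  where
  section-injective : IsPerm (proj₁ ∘ surj)
  section-injective j j′ e = trans (sym (proj₂ (surj j))) (trans (cong f e) (proj₂ (surj j′)))
... | j , refl | j′ , refl =
  cong (proj₁ ∘ surj) (trans (sym (proj₂ (surj j))) (trans fi≡fi′ (proj₂ (surj j′))))

injective⇒count-one : {f : Fin n → Fin n} → IsPerm f → ∀ j → ∑ (allFin n) (λ i → ⟦ f i ≟ j ⟧) ≡ 1ℤ
injective⇒count-one {n} {f} inj j with injective⇒surjective inj j
... | i , refl = trans
  (∑-cong (allFin n) (λ i′ → ⟦⟧-cong (f i′ ≟ f i) (i′ ≟ i) (inj i′ i) (cong f)))
  (∑-allFin-count n i)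

count-one⇒injective : {f : Fin n → Fin n} → (∀ j → ∑ (allFin n) (λ i → ⟦ f i ≟ j ⟧) ≡ 1ℤ) → IsPerm f
count-one⇒injective {n} {f} count = surjective⇒injective hit
  where
  hit : ∀ j → ∃ λ i → f i ≡ j
  hit j with any? (λ i → f i ≟ j)
  ... | yes h   = h
  ... | no miss = contradiction
    (trans (sym (∑-zero (allFin n)))
      (trans (∑-cong (allFin n) (λ i → sym (⟦⟧-false (f i ≟ j) (λ e → miss (i , e))))) (count j)))
    (λ ())

-- The coefficient as a signed count of Latin squares

∑-upTo-suc : ∀ k (f : ℕ → ℤ) → ∑ (upTo (suc k)) f ≡ f 0 +ℤ ∑ (upTo k) (f ∘ suc)
∑-upTo-suc k f = cong sumℤ (trans (map-upTo f (suc k)) (cong (f 0 ∷_) (sym (map-upTo (f ∘ suc) k))))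

∑-upTo-count : ∀ k a → ∑ (upTo k) (λ x → ⟦ x ℕ.≟ a ⟧) ≡ ⟦ a ℕ.<? k ⟧
∑-upTo-count zero    a       = sym (⟦⟧-false (a ℕ.<? 0) (λ ()))
∑-upTo-count (suc k) zero    = begin
  ∑ (upTo (suc k)) (λ x → ⟦ x ℕ.≟ 0 ⟧)        ≡⟨ ∑-upTo-suc k (λ x → ⟦ x ℕ.≟ 0 ⟧) ⟩
  1ℤ +ℤ ∑ (upTo k) (λ x → ⟦ suc x ℕ.≟ 0 ⟧)    ≡⟨ cong (1ℤ +ℤ_) (∑-cong (upTo k) (λ x → ⟦⟧-false (suc x ℕ.≟ 0) (λ ()))) ⟩
  1ℤ +ℤ ∑ (upTo k) (λ x → 0ℤ)                 ≡⟨ cong (1ℤ +ℤ_) (∑-zero (upTo k)) ⟩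
  1ℤ                                          ≡⟨ sym (⟦⟧-true (0 ℕ.<? suc k) (ℕ.s≤s ℕ.z≤n)) ⟩
  ⟦ 0 ℕ.<? suc k ⟧                            ∎
∑-upTo-count (suc k) (suc a) = begin
  ∑ (upTo (suc k)) (λ x → ⟦ x ℕ.≟ suc a ⟧)      ≡⟨ ∑-upTo-suc k (λ x → ⟦ x ℕ.≟ suc a ⟧) ⟩
  0ℤ +ℤ ∑ (upTo k) (λ x → ⟦ suc x ℕ.≟ suc a ⟧)  ≡⟨ ℤ.+-identityˡ _ ⟩
  ∑ (upTo k) (λ x → ⟦ suc x ℕ.≟ suc a ⟧)        ≡⟨ ∑-cong (upTo k) (λ x → ⟦⟧-cong (suc x ℕ.≟ suc a) (x ℕ.≟ a) ℕ.suc-injective (cong suc)) ⟩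
  ∑ (upTo k) (λ x → ⟦ x ℕ.≟ a ⟧)                ≡⟨ ∑-upTo-count k a ⟩
  ⟦ a ℕ.<? k ⟧                                  ≡⟨ ⟦⟧-cong (a ℕ.<? k) (suc a ℕ.<? suc k) ℕ.s≤s ℕ.s≤s⁻¹ ⟩
  ⟦ suc a ℕ.<? suc k ⟧                          ∎

-- Divisors of monomials and coefficients of products

infixl 6 _+M_ _∸M_

_+M_ _∸M_ : Monomial n → Monomial n → Monomial n
(a +M b) i j = a i j ℕ.+ b i j
(a ∸M b) i j = a i j ∸ b i j

-- Divisibility is entrywise ≤, written with `suc` to match the bound `upTo (suc …)` in `divisors`.
_∣M?_ : (a m : Monomial n) → Dec (∀ i j → a i j ℕ.< suc (m i j))
a ∣M? m = all? (λ i → all? (λ j → a i j ℕ.<? suc (m i j)))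

∑-divisors-count : (m a : Monomial n) → ∑ (divisors m) (λ d → ⟦ d ≟M a ⟧) ≡ ⟦ a ∣M? m ⟧
∑-divisors-count {n} m a =
  ∑-boxes-count (λ (x y : Fin n → ℕ) → all? (λ j → x j ℕ.≟ y j)) n
    (λ i → boxes n (λ j → upTo (suc (m i j)))) a (λ i → all? (λ j → a i j ℕ.<? suc (m i j)))
    (λ i → ∑-boxes-count ℕ._≟_ n (λ j → upTo (suc (m i j))) (a i) (λ j → a i j ℕ.<? suc (m i j))
      (λ j → ∑-upTo-count (suc (m i j)) (a i j)))

-- Truncated subtraction can give m ∸ a = b although a does not divide m; summing over divisors
-- supplies the missing inequality.
∑-divisors-product : (m a b : Monomial n) →
  ∑ (divisors m) (λ d → ⟦ d ≟M a ⟧ *ℤ ⟦ (m ∸M d) ≟M b ⟧) ≡ ⟦ m ≟M (a +M b) ⟧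
∑-divisors-product m a b = begin
  ∑ (divisors m) (λ d → ⟦ d ≟M a ⟧ *ℤ ⟦ (m ∸M d) ≟M b ⟧)
    ≡⟨ ∑-cong (divisors m) (λ d → ⟦⟧*-cong (d ≟M a) (λ d≡a → ⟦⟧-cong ((m ∸M d) ≟M b) ((m ∸M a) ≟M b)
         (λ e i j → trans (cong (m i j ∸_) (sym (d≡a i j))) (e i j))
         (λ e i j → trans (cong (m i j ∸_) (d≡a i j)) (e i j)))) ⟩
  ∑ (divisors m) (λ d → ⟦ d ≟M a ⟧ *ℤ ⟦ (m ∸M a) ≟M b ⟧)
    ≡⟨ sym (∑-distribʳ-* (divisors m) ⟦ (m ∸M a) ≟M b ⟧ (λ d → ⟦ d ≟M a ⟧)) ⟩
  ∑ (divisors m) (λ d → ⟦ d ≟M a ⟧) *ℤ ⟦ (m ∸M a) ≟M b ⟧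
    ≡⟨ cong (_*ℤ ⟦ (m ∸M a) ≟M b ⟧) (∑-divisors-count m a) ⟩
  ⟦ a ∣M? m ⟧ *ℤ ⟦ (m ∸M a) ≟M b ⟧
    ≡⟨ sym (⟦⟧-× (a ∣M? m) ((m ∸M a) ≟M b)) ⟩
  ⟦ (a ∣M? m) ×-dec ((m ∸M a) ≟M b) ⟧
    ≡⟨ ⟦⟧-cong ((a ∣M? m) ×-dec ((m ∸M a) ≟M b)) (m ≟M (a +M b))
         (λ (a≤m , e) i j → trans (sym (ℕ.m+[n∸m]≡n (ℕ.s≤s⁻¹ (a≤m i j)))) (cong (a i j ℕ.+_) (e i j)))
         (λ e → (λ i j → ℕ.s≤s (ℕ.≤-trans (ℕ.m≤m+n (a i j) (b i j)) (ℕ.≤-reflexive (sym (e i j)))))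
              , (λ i j → trans (cong (_∸ a i j) (e i j)) (ℕ.m+n∸m≡n (a i j) (b i j)))) ⟩
  ⟦ m ≟M (a +M b) ⟧ ∎

-- Different indices may carry the same monomial, so the expansion is a weighted family and not a
-- normal form.
record Expands {n : ℕ} {I : Set} (p : Poly n) (xs : List I) (c : I → ℤ) (μ : I → Monomial n) : Set where
  constructor expands
  field coefficient : ∀ m → p m ≡ ∑ xs (λ x → c x *ℤ ⟦ m ≟M μ x ⟧)

-- The result stays an iterated sum: this is the form that `∑-boxes-suc` folds into one sum over
-- longer tuples.
*P-expand : {p q : Poly n} {xs : List I} {ys : List J} {c : I → ℤ} {d : J → ℤ} {μ : I → Monomial n} {ν : J → Monomial n} →
  Expands p xs c μ → Expands q ys d ν →
  ∀ m → (p *P q) m ≡ ∑ xs (λ x → ∑ ys (λ y → (c x *ℤ d y) *ℤ ⟦ m ≟M (μ x +M ν y) ⟧))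
*P-expand {p = p} {q} {xs} {ys} {c} {d} {μ} {ν} (expands expP) (expands expQ) m = begin
  ∑ (divisors m) (λ a → p a *ℤ q (m ∸M a))
    ≡⟨ ∑-cong (divisors m) (λ a → cong₂ _*ℤ_ (expP a) (expQ (m ∸M a))) ⟩
  ∑ (divisors m) (λ a → ∑ xs (λ x → c x *ℤ ⟦ a ≟M μ x ⟧) *ℤ ∑ ys (λ y → d y *ℤ ⟦ (m ∸M a) ≟M ν y ⟧))
    ≡⟨ ∑-cong (divisors m) (λ a → ∑-distribʳ-* xs (∑ ys (λ y → d y *ℤ ⟦ (m ∸M a) ≟M ν y ⟧)) (λ x → c x *ℤ ⟦ a ≟M μ x ⟧)) ⟩
  ∑ (divisors m) (λ a → ∑ xs (λ x → (c x *ℤ ⟦ a ≟M μ x ⟧) *ℤ ∑ ys (λ y → d y *ℤ ⟦ (m ∸M a) ≟M ν y ⟧)))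
    ≡⟨ ∑-comm (divisors m) xs _ ⟩
  ∑ xs (λ x → ∑ (divisors m) (λ a → (c x *ℤ ⟦ a ≟M μ x ⟧) *ℤ ∑ ys (λ y → d y *ℤ ⟦ (m ∸M a) ≟M ν y ⟧)))
    ≡⟨ ∑-cong xs (λ x → ∑-cong (divisors m) (λ a → ∑-distribˡ-* ys (c x *ℤ ⟦ a ≟M μ x ⟧) (λ y → d y *ℤ ⟦ (m ∸M a) ≟M ν y ⟧))) ⟩
  ∑ xs (λ x → ∑ (divisors m) (λ a → ∑ ys (λ y → (c x *ℤ ⟦ a ≟M μ x ⟧) *ℤ (d y *ℤ ⟦ (m ∸M a) ≟M ν y ⟧))))
    ≡⟨ ∑-cong xs (λ x → ∑-comm (divisors m) ys _) ⟩
  ∑ xs (λ x → ∑ ys (λ y → ∑ (divisors m) (λ a → (c x *ℤ ⟦ a ≟M μ x ⟧) *ℤ (d y *ℤ ⟦ (m ∸M a) ≟M ν y ⟧))))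
    ≡⟨ ∑-cong xs (λ x → ∑-cong ys (λ y → term x y)) ⟩
  ∑ xs (λ x → ∑ ys (λ y → (c x *ℤ d y) *ℤ ⟦ m ≟M (μ x +M ν y) ⟧)) ∎
  where
  term : ∀ x y → ∑ (divisors m) (λ a → (c x *ℤ ⟦ a ≟M μ x ⟧) *ℤ (d y *ℤ ⟦ (m ∸M a) ≟M ν y ⟧)) ≡
                 (c x *ℤ d y) *ℤ ⟦ m ≟M (μ x +M ν y) ⟧
  term x y = begin
    ∑ (divisors m) (λ a → (c x *ℤ ⟦ a ≟M μ x ⟧) *ℤ (d y *ℤ ⟦ (m ∸M a) ≟M ν y ⟧))
      ≡⟨ ∑-cong (divisors m) (λ a → solve 4 (λ s t u v → (s :* t) :* (u :* v) := (s :* u) :* (t :* v)) refl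
           (c x) ⟦ a ≟M μ x ⟧ (d y) ⟦ (m ∸M a) ≟M ν y ⟧) ⟩
    ∑ (divisors m) (λ a → (c x *ℤ d y) *ℤ (⟦ a ≟M μ x ⟧ *ℤ ⟦ (m ∸M a) ≟M ν y ⟧))
      ≡⟨ sym (∑-distribˡ-* (divisors m) (c x *ℤ d y) (λ a → ⟦ a ≟M μ x ⟧ *ℤ ⟦ (m ∸M a) ≟M ν y ⟧)) ⟩
    (c x *ℤ d y) *ℤ ∑ (divisors m) (λ a → ⟦ a ≟M μ x ⟧ *ℤ ⟦ (m ∸M a) ≟M ν y ⟧)
      ≡⟨ cong ((c x *ℤ d y) *ℤ_) (∑-divisors-product m (μ x) (ν y)) ⟩
    (c x *ℤ d y) *ℤ ⟦ m ≟M (μ x +M ν y) ⟧ ∎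

sumP-eval : ∀ (xs : List I) (p : I → Poly n) m → sumP (map p xs) m ≡ ∑ xs (λ x → p x m)
sumP-eval []       p m = refl
sumP-eval (x ∷ xs) p m = cong (p x m +ℤ_) (sumP-eval xs p m)

∑-singleton : ∀ (f : ⊤ → ℤ) → ∑ (tt ∷ []) f ≡ f tt
∑-singleton f = ℤ.+-identityʳ (f tt)

record IsTerm {n : ℕ} (p : Poly n) (c : ℤ) (μ : Monomial n) : Set where
  constructor isTerm
  field coefficient : ∀ m → p m ≡ c *ℤ ⟦ m ≟M μ ⟧

term-expand : {p : Poly n} {c : ℤ} {μ : Monomial n} → IsTerm p c μ → Expands p (tt ∷ []) (λ _ → c) (λ _ → μ)
term-expand (isTerm t) = expands (λ m → trans (t m) (sym (∑-singleton _)))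

term-* : {p q : Poly n} {c d : ℤ} {μ ν : Monomial n} → IsTerm p c μ → IsTerm q d ν → IsTerm (p *P q) (c *ℤ d) (μ +M ν)
term-* t u = isTerm (λ m → trans (*P-expand (term-expand t) (term-expand u) m) (trans (∑-singleton _) (∑-singleton _)))

sum-expand : (xs : List I) {p : I → Poly n} {c : I → ℤ} {μ : I → Monomial n} →
  (∀ x → IsTerm (p x) (c x) (μ x)) → Expands (sumP (map p xs)) xs c μ
sum-expand xs {p} t = expands (λ m → trans (sumP-eval xs p m) (∑-cong xs (λ x → IsTerm.coefficient (t x) m)))

constP-term : ∀ (c : ℤ) → IsTerm {n} (constP c) c zeroMon
constP-term c = isTerm (λ m → if-indicator (m ≟M zeroMon))
  where
  if-indicator : (P? : Dec P) → (if does P? then c else 0ℤ) ≡ c *ℤ ⟦ P? ⟧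
  if-indicator (yes _) = sym (ℤ.*-identityʳ c)
  if-indicator (no _)  = sym (ℤ.*-zeroʳ c)

-- Expansion of the permanent and of powers of the determinant

X-term : ∀ (i j : Fin n) → IsTerm (X i j) 1ℤ (varMon i j)
X-term i j = isTerm (λ m → sym (ℤ.*-identityˡ _))

-- Kept as the fold that `prodP` produces, so that the expansion follows the recursion of the
-- product; `permMon-entry` identifies it as the permutation matrix.
permMon : (Fin n → Fin n) → Monomial n
permMon {n} σ = foldr (λ i a → varMon i (σ i) +M a) zeroMon (allFin n)

permProduct-term : (σ : Fin n → Fin n) → IsTerm (prodP (map (λ i → X i (σ i)) (allFin n))) 1ℤ (permMon σ)
permProduct-term {n} σ = go (allFin n)
  where
  go : ∀ xs → IsTerm (prodP (map (λ i → X i (σ i)) xs)) 1ℤ (foldr (λ i a → varMon i (σ i) +M a) zeroMon xs)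
  go []       = constP-term 1ℤ
  go (x ∷ xs) = term-* (X-term x (σ x)) (go xs)

permMon-entry : (σ : Fin n → Fin n) (i j : Fin n) → + permMon σ i j ≡ ⟦ σ i ≟ j ⟧
permMon-entry {n} σ i j = begin
  + permMon σ i j
    ≡⟨ go (allFin n) ⟩
  ∑ (allFin n) (λ k → ⟦ k ≟ i ⟧ *ℤ ⟦ σ k ≟ j ⟧)
    ≡⟨ ∑-cong (allFin n) (λ k → ⟦⟧*-cong (k ≟ i) (λ k≡i → cong (λ l → ⟦ σ l ≟ j ⟧) k≡i)) ⟩
  ∑ (allFin n) (λ k → ⟦ k ≟ i ⟧ *ℤ ⟦ σ i ≟ j ⟧)
    ≡⟨ sym (∑-distribʳ-* (allFin n) ⟦ σ i ≟ j ⟧ (λ k → ⟦ k ≟ i ⟧)) ⟩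
  ∑ (allFin n) (λ k → ⟦ k ≟ i ⟧) *ℤ ⟦ σ i ≟ j ⟧
    ≡⟨ cong (_*ℤ ⟦ σ i ≟ j ⟧) (∑-allFin-count n i) ⟩
  1ℤ *ℤ ⟦ σ i ≟ j ⟧
    ≡⟨ ℤ.*-identityˡ _ ⟩
  ⟦ σ i ≟ j ⟧ ∎
  where
  entry : ∀ k → + varMon k (σ k) i j ≡ ⟦ k ≟ i ⟧ *ℤ ⟦ σ k ≟ j ⟧
  entry k with k ≟ i | σ k ≟ j
  ... | yes _ | yes _ = refl
  ... | yes _ | no _  = refl
  ... | no _  | _     = refl
  go : ∀ xs → + foldr (λ k a → varMon k (σ k) +M a) zeroMon xs i j ≡ ∑ xs (λ k → ⟦ k ≟ i ⟧ *ℤ ⟦ σ k ≟ j ⟧)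
  go []       = refl
  go (x ∷ xs) = trans (ℤ.pos-+ (varMon x (σ x) i j) _) (cong₂ _+ℤ_ (entry x) (go xs))

tupleMon : ∀ {k} → (Fin k → Fin n → Fin n) → Monomial n
tupleMon f i j = VF.foldr ℕ._+_ 0 (λ l → permMon (f l) i j)

per-expand : Expands (per n) (perms n) (λ _ → 1ℤ) permMon
per-expand {n} = sum-expand (perms n) permProduct-term

det-expand : Expands (det n) (perms n) (λ σ → sgn σ *ℤ 1ℤ) (λ σ → zeroMon +M permMon σ)
det-expand {n} = sum-expand (perms n) (λ σ → term-* (constP-term (sgn σ)) (permProduct-term σ))

det^-expand : ∀ k → Expands (det n ^P k) (allFuns k (perms n)) (λ f → ∏ (λ l → sgn (f l))) tupleMon
det^-expand {n} zero    = expands (λ m → trans (IsTerm.coefficient (constP-term 1ℤ) m) (sym (ℤ.+-identityʳ _)))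
det^-expand {n} (suc k) = expands (λ m → begin
  (det n *P (det n ^P k)) m
    -- `zeroMon +M permMon σ` computes to `permMon σ`, so of the constant factor in `det` just the
    -- trailing 1 has to be removed afterwards.
    ≡⟨ *P-expand (det-expand {n}) (det^-expand k) m ⟩
  ∑ (perms n) (λ σ → ∑ (allFuns k (perms n)) (λ f →
    (sgn σ *ℤ 1ℤ *ℤ ∏ (λ l → sgn (f l))) *ℤ ⟦ m ≟M (permMon σ +M tupleMon f) ⟧))
    ≡⟨ ∑-cong (perms n) (λ σ → ∑-cong (allFuns k (perms n)) (λ f →
         cong (λ s → (s *ℤ ∏ (λ l → sgn (f l))) *ℤ ⟦ m ≟M (permMon σ +M tupleMon f) ⟧) (ℤ.*-identityʳ (sgn σ)))) ⟩
  ∑ (perms n) (λ σ → ∑ (allFuns k (perms n)) (λ f →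
    (sgn σ *ℤ ∏ (λ l → sgn (f l))) *ℤ ⟦ m ≟M (permMon σ +M tupleMon f) ⟧))
    ≡⟨ sym (∑-boxes-suc k (λ _ → perms n) (λ f → ∏ (λ l → sgn (f l)) *ℤ ⟦ m ≟M tupleMon f ⟧)) ⟩
  ∑ (allFuns (suc k) (perms n)) (λ f → ∏ (λ l → sgn (f l)) *ℤ ⟦ m ≟M tupleMon f ⟧) ∎)

tupleMon-entry : ∀ {k} (f : Fin k → Fin n → Fin n) i j → + tupleMon f i j ≡ ∑ (allFin k) (λ l → ⟦ f l i ≟ j ⟧)
tupleMon-entry {k = zero}  f i j = refl
tupleMon-entry {k = suc k} f i j = begin
  + (permMon (f zero) i j ℕ.+ tupleMon (f ∘ suc) i j)
    ≡⟨ ℤ.pos-+ (permMon (f zero) i j) _ ⟩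
  + permMon (f zero) i j +ℤ + tupleMon (f ∘ suc) i j
    ≡⟨ cong₂ _+ℤ_ (permMon-entry (f zero) i j) (tupleMon-entry (f ∘ suc) i j) ⟩
  ⟦ f zero i ≟ j ⟧ +ℤ ∑ (allFin k) (λ l → ⟦ f (suc l) i ≟ j ⟧)
    ≡⟨ sym (∑-allFin-suc k (λ l → ⟦ f l i ≟ j ⟧)) ⟩
  ∑ (allFin (suc k)) (λ l → ⟦ f l i ≟ j ⟧) ∎

-- The exponent of X_ij in the product of the row monomials counts the rows k with `R k i ≡ j`;
-- exponent 1 everywhere means that each column of R is a bijection.
isLatin-indicator : (R : Square n) →
  ⟦ all? (λ k → isPerm? (R k)) ⟧ *ℤ ⟦ allOnes ≟M tupleMon R ⟧ ≡ ⟦ isLatin? R ⟧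
isLatin-indicator R = trans
  (sym (⟦⟧-× (all? (λ k → isPerm? (R k))) (allOnes ≟M tupleMon R)))
  (⟦⟧-cong (all? (λ k → isPerm? (R k)) ×-dec (allOnes ≟M tupleMon R)) (isLatin? R)
    (λ (rows , ones) → rows , λ i → count-one⇒injective (λ j → trans (sym (tupleMon-entry R i j)) (cong +_ (sym (ones i j)))))
    (λ (rows , cols) → rows , λ i j → ℤ.+-injective (trans (sym (injective⇒count-one (cols i) j)) (sym (tupleMon-entry R i j)))))

-- Row `zero` is the permutation chosen in the permanent and carries no sign; the rows `suc k` come
-- from the m determinants.
coeff-Latin : ∀ m → coeff (per (suc m) *P (det (suc m) ^P m)) allOnes ≡
  ∑ (allSquares (suc m)) (λ R → ⟦ isLatin? R ⟧ *ℤ ∏ (λ k → sgn (R (suc k))))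
coeff-Latin m = begin
  (per N *P (det N ^P m)) allOnes
    ≡⟨ *P-expand (per-expand {N}) (det^-expand m) allOnes ⟩
  ∑ (perms N) (λ σ → ∑ (allFuns m (perms N)) (λ f →
    (1ℤ *ℤ ∏ (λ l → sgn (f l))) *ℤ ⟦ allOnes ≟M (permMon σ +M tupleMon f) ⟧))
    ≡⟨ ∑-cong (perms N) (λ σ → ∑-cong (allFuns m (perms N)) (λ f →
         cong (_*ℤ ⟦ allOnes ≟M (permMon σ +M tupleMon f) ⟧) (ℤ.*-identityˡ (∏ (λ l → sgn (f l)))))) ⟩
  ∑ (perms N) (λ σ → ∑ (allFuns m (perms N)) (λ f →
    ∏ (λ l → sgn (f l)) *ℤ ⟦ allOnes ≟M (permMon σ +M tupleMon f) ⟧))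
    ≡⟨ sym (∑-boxes-suc m (λ _ → perms N) (λ R → ∏ (λ k → sgn (R (suc k))) *ℤ ⟦ allOnes ≟M tupleMon R ⟧)) ⟩
  ∑ (allFuns N (perms N)) (λ R → ∏ (λ k → sgn (R (suc k))) *ℤ ⟦ allOnes ≟M tupleMon R ⟧)
    ≡⟨ ∑-allFuns-filter isPerm? N (allFuns N (allFin N)) _ ⟩
  ∑ (allSquares N) (λ R → ⟦ all? (λ k → isPerm? (R k)) ⟧ *ℤ (∏ (λ k → sgn (R (suc k))) *ℤ ⟦ allOnes ≟M tupleMon R ⟧))
    ≡⟨ ∑-cong (allSquares N) (λ R → trans
         (solve 3 (λ a b c → a :* (b :* c) := (a :* c) :* b) refl ⟦ all? (λ k → isPerm? (R k)) ⟧ (∏ (λ k → sgn (R (suc k)))) ⟦ allOnes ≟M tupleMon R ⟧)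
         (cong (_*ℤ ∏ (λ k → sgn (R (suc k)))) (isLatin-indicator R))) ⟩
  ∑ (allSquares N) (λ R → ⟦ isLatin? R ⟧ *ℤ ∏ (λ k → sgn (R (suc k)))) ∎
  where N = suc m

-- Products over Fin n

∏-reindex : {f : Fin n → Fin n} → IsPerm f → ∀ h → ∏ (h ∘ f) ≡ ∏ h
∏-reindex {f = f} inj h = sym (∏-permute h
  (permutation f (proj₁ ∘ surj) (proj₂ ∘ surj) (λ i → inj _ i (proj₂ (surj (f i))))))
  where surj = injective⇒surjective inj

prodℤ-∏ : ∀ n (f : Fin n → ℤ) → prodℤ (map f (allFin n)) ≡ ∏ f
prodℤ-∏ n f = trans (cong prodℤ (map-tabulate (λ i → i) f)) (go n f)
  where
  go : ∀ n (f : Fin n → ℤ) → prodℤ (tabulate f) ≡ ∏ f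
  go zero    f = refl
  go (suc n) f = cong (f zero *ℤ_) (go n (f ∘ suc))

^-sumℕ : ∀ x n (f : Fin n → ℕ) → x ^ sumℕ (map f (allFin n)) ≡ ∏ (λ i → x ^ f i)
^-sumℕ x n f = trans (cong (λ e → x ^ sumℕ e) (map-tabulate (λ i → i) f)) (go n f)
  where
  go : ∀ n (f : Fin n → ℕ) → x ^ sumℕ (tabulate f) ≡ ∏ (λ i → x ^ f i)
  go zero    f = refl
  go (suc n) f = trans (ℤ.^-distribˡ-+-* x (f zero) _) (cong (x ^ f zero *ℤ_) (go n (f ∘ suc)))

-- Multiplicative counterpart of an indicator: excluded factors become 1, so products over pairs i <
-- j are full products.
guard : Bool → ℤ → ℤ
guard b x = if b then x else 1ℤ

guard-* : ∀ b x y → guard b (x *ℤ y) ≡ guard b x *ℤ guard b y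
guard-* true  x y = refl
guard-* false x y = refl

guard-1 : ∀ b → guard b 1ℤ ≡ 1ℤ
guard-1 true  = refl
guard-1 false = refl

guard-∏ : ∀ b (f : Fin n → ℤ) → guard b (∏ f) ≡ ∏ (λ i → guard b (f i))
guard-∏     true  f = refl
guard-∏ {n} false f = sym (∏-one n)

∏-delta : ∀ (i : Fin n) (f : Fin n → ℤ) → ∏ (λ j → guard (does (i ≟ j)) (f j)) ≡ f i
∏-delta {suc n} zero    f = trans (cong (f zero *ℤ_) (∏-one n)) (ℤ.*-identityʳ (f zero))
∏-delta {suc n} (suc i) f = trans (ℤ.*-identityˡ _) (∏-delta i (f ∘ suc))

∏₂ : (Fin n → Fin n → ℤ) → ℤ
∏₂ k = ∏ (λ i → ∏ (k i))

∏₂-cong : {k l : Fin n → Fin n → ℤ} → (∀ i j → k i j ≡ l i j) → ∏₂ k ≡ ∏₂ l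
∏₂-cong eq = ∏-cong (λ i → ∏-cong (eq i))

∏₂-distrib-* : (k l : Fin n → Fin n → ℤ) → ∏₂ (λ i j → k i j *ℤ l i j) ≡ ∏₂ k *ℤ ∏₂ l
∏₂-distrib-* k l = trans (∏-cong (λ i → ∏-distrib-* (k i) (l i))) (∏-distrib-* (λ i → ∏ (k i)) (λ i → ∏ (l i)))

∏₂-one : ∀ n → ∏₂ {n} (λ _ _ → 1ℤ) ≡ 1ℤ
∏₂-one n = trans (∏-cong {n} {λ _ → ∏ {n} (λ _ → 1ℤ)} {λ _ → 1ℤ} (λ _ → ∏-one n)) (∏-one n)

∏₂-delta : (k : Fin n → Fin n → ℤ) → ∏₂ (λ i j → guard (does (i ≟ j)) (k i j)) ≡ ∏ (λ i → k i i)
∏₂-delta {n} k = ∏-cong {n} (λ i → ∏-delta i (k i))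

∏₂-reindex : {f g : Fin n → Fin n} → IsPerm f → IsPerm g → ∀ k → ∏₂ (λ i j → k (f i) (g j)) ≡ ∏₂ k
∏₂-reindex {f = f} perm-f perm-g k = trans
  (∏-cong (λ i → ∏-reindex perm-g (k (f i)))) (∏-reindex perm-f (λ i → ∏ (k i)))

guard-∏₂ : ∀ b (k : Fin n → Fin n → ℤ) → guard b (∏₂ k) ≡ ∏₂ (λ i j → guard b (k i j))
guard-∏₂ b k = trans (guard-∏ b (λ i → ∏ (k i))) (∏-cong (λ i → guard-∏ b (k i)))

∏-∏₂-comm : ∀ {m} (k : Fin m → Fin n → Fin n → ℤ) → ∏ (λ x → ∏₂ (k x)) ≡ ∏₂ (λ i j → ∏ (λ x → k x i j))
∏-∏₂-comm k = trans (∏-comm (λ x i → ∏ (k x i))) (∏-cong (λ i → ∏-comm (λ x j → k x i j)))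

∏-∏₂-guard-comm : ∀ {m} (b : Fin n → Fin n → Bool) (k : Fin m → Fin n → Fin n → ℤ) →
  ∏ (λ x → ∏₂ (λ i j → guard (b i j) (k x i j))) ≡ ∏₂ (λ i j → guard (b i j) (∏ (λ x → k x i j)))
∏-∏₂-guard-comm b k = trans (∏-∏₂-comm (λ x i j → guard (b i j) (k x i j)))
  (∏₂-cong (λ i j → sym (guard-∏ (b i j) (λ x → k x i j))))

-- Lets a product over pairs of rows and pairs of columns be read in either order.
∏₂-∏₂-guard-comm : (b c : Fin n → Fin n → Bool) (k : Fin n → Fin n → Fin n → Fin n → ℤ) →
  ∏₂ (λ i j → guard (b i j) (∏₂ (λ x y → guard (c x y) (k i j x y)))) ≡
  ∏₂ (λ x y → guard (c x y) (∏₂ (λ i j → guard (b i j) (k i j x y))))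
∏₂-∏₂-guard-comm b c k = begin
  ∏₂ (λ i j → guard (b i j) (∏₂ (λ x y → guard (c x y) (k i j x y))))
    ≡⟨ ∏₂-cong (λ i j → guard-∏₂ (b i j) (λ x y → guard (c x y) (k i j x y))) ⟩
  ∏₂ (λ i j → ∏₂ (λ x y → guard (b i j) (guard (c x y) (k i j x y))))
    ≡⟨ ∏₂-cong (λ i j → ∏₂-cong (λ x y → guard-guard (b i j) (c x y) (k i j x y))) ⟩
  ∏₂ (λ i j → ∏₂ (λ x y → guard (c x y) (guard (b i j) (k i j x y))))
    ≡⟨ ∏-cong (λ i → ∏-∏₂-guard-comm c (λ j x y → guard (b i j) (k i j x y))) ⟩
  ∏ (λ i → ∏₂ (λ x y → guard (c x y) (∏ (λ j → guard (b i j) (k i j x y)))))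
    ≡⟨ ∏-∏₂-guard-comm c (λ i x y → ∏ (λ j → guard (b i j) (k i j x y))) ⟩
  ∏₂ (λ x y → guard (c x y) (∏₂ (λ i j → guard (b i j) (k i j x y)))) ∎
  where
  guard-guard : ∀ b c x → guard b (guard c x) ≡ guard c (guard b x)
  guard-guard true  c x = refl
  guard-guard false c x = sym (guard-1 c)

-- Order comparisons and products over pairs

lt : Fin n → Fin n → Bool
lt i j = toℕ i <ᵇ toℕ j

-- The Boolean outcomes are stored as equations so that `rewrite` can evaluate the guards.
data Comparison (i j : Fin n) : Set where
  less    : lt i j ≡ true  → lt j i ≡ false → i ≢ j → Comparison i j
  equal   : lt i j ≡ false → i ≡ j → Comparison i j
  greater : lt i j ≡ false → lt j i ≡ true → i ≢ j → Comparison i j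

compare : (i j : Fin n) → Comparison i j
compare zero    zero    = equal refl refl
compare zero    (suc j) = less refl refl (λ ())
compare (suc i) zero    = greater refl refl (λ ())
compare (suc i) (suc j) with compare i j
... | less p q i≢j    = less p q (λ { refl → i≢j refl })
... | equal p refl    = equal p refl
... | greater p q i≢j = greater p q (λ { refl → i≢j refl })

lt-irrefl : (i : Fin n) → lt i i ≡ false
lt-irrefl zero    = refl
lt-irrefl (suc i) = lt-irrefl i

≟-refl : (i : Fin n) → does (i ≟ i) ≡ true
≟-refl i = dec-true (i ≟ i) refl

≟-≢ : {i j : Fin n} → i ≢ j → does (i ≟ j) ≡ false
≟-≢ {i = i} {j} i≢j = dec-false (i ≟ j) i≢j

-- Each factor lies above, below or on the diagonal; transposing the part below pairs `k j i` with
-- `k i j`.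
∏₂-pairs : (k : Fin n → Fin n → ℤ) →
  ∏₂ k ≡ ∏₂ (λ i j → guard (lt i j) (k i j *ℤ k j i)) *ℤ ∏ (λ i → k i i)
∏₂-pairs k = begin
  ∏₂ k
    ≡⟨ ∏₂-cong split ⟩
  ∏₂ (λ i j → above i j *ℤ below i j *ℤ diagonal i j)
    ≡⟨ trans (∏₂-distrib-* (λ i j → above i j *ℤ below i j) diagonal) (cong (_*ℤ ∏₂ diagonal) (∏₂-distrib-* above below)) ⟩
  ∏₂ above *ℤ ∏₂ below *ℤ ∏₂ diagonal
    ≡⟨ cong (λ p → ∏₂ above *ℤ p *ℤ ∏₂ diagonal) (∏-comm below) ⟩
  ∏₂ above *ℤ ∏₂ (λ i j → below j i) *ℤ ∏₂ diagonal
    ≡⟨ cong₂ _*ℤ_ (sym (∏₂-distrib-* above (λ i j → below j i))) (∏₂-delta k) ⟩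
  ∏₂ (λ i j → above i j *ℤ below j i) *ℤ ∏ (λ i → k i i)
    ≡⟨ cong (_*ℤ ∏ (λ i → k i i)) (∏₂-cong (λ i j → sym (guard-* (lt i j) (k i j) (k j i)))) ⟩
  ∏₂ (λ i j → guard (lt i j) (k i j *ℤ k j i)) *ℤ ∏ (λ i → k i i) ∎
  where
  above below diagonal : Fin _ → Fin _ → ℤ
  above    i j = guard (lt i j) (k i j)
  below    i j = guard (lt j i) (k i j)
  diagonal i j = guard (does (i ≟ j)) (k i j)
  split : ∀ i j → k i j ≡ above i j *ℤ below i j *ℤ diagonal i j
  split i j with compare i j
  ... | less p q i≢j    rewrite p | q | ≟-≢ i≢j = sym (trans (ℤ.*-identityʳ _) (ℤ.*-identityʳ _))
  ... | equal p refl    rewrite p | ≟-refl i    = sym (ℤ.*-identityˡ _)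
  ... | greater p q i≢j rewrite p | q | ≟-≢ i≢j = sym (trans (ℤ.*-identityʳ _) (ℤ.*-identityˡ _))

-- Signs

IsSign : ℤ → Set
IsSign x = x ≡ 1ℤ ⊎ x ≡ -1ℤ

*-isSign : ∀ {x y} → IsSign x → IsSign y → IsSign (x *ℤ y)
*-isSign (inj₁ refl) (inj₁ refl) = inj₁ refl
*-isSign (inj₁ refl) (inj₂ refl) = inj₂ refl
*-isSign (inj₂ refl) (inj₁ refl) = inj₂ refl
*-isSign (inj₂ refl) (inj₂ refl) = inj₁ refl

∏-isSign : {f : Fin n → ℤ} → (∀ i → IsSign (f i)) → IsSign (∏ f)
∏-isSign {zero}  s = inj₁ refl
∏-isSign {suc n} s = *-isSign (s zero) (∏-isSign (s ∘ suc))

isSign-square : ∀ {x} → IsSign x → x *ℤ x ≡ 1ℤ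
isSign-square (inj₁ refl) = refl
isSign-square (inj₂ refl) = refl

sgn-isSign : (f : Fin n → Fin n) → IsSign (sgn f)
sgn-isSign f = go (inversions f)
  where
  go : ∀ k → IsSign (-1ℤ ^ k)
  go zero    = inj₁ refl
  go (suc k) = *-isSign (inj₂ refl) (go k)

-- The sign of y − x, with value 1 at x = y.
orient : Fin n → Fin n → ℤ
orient x y = guard (lt y x) -1ℤ

orient-isSign : (x y : Fin n) → IsSign (orient x y)
orient-isSign x y with lt y x
... | true  = inj₂ refl
... | false = inj₁ refl

orient-refl : (x : Fin n) → orient x x ≡ 1ℤ
orient-refl x = cong (λ b → guard b -1ℤ) (lt-irrefl x)

-- Exchanging distinct arguments negates each factor, and the two changes of sign cancel.
orient-pair-symmetric : {x y u v : Fin n} → x ≢ y → u ≢ v →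
  orient x y *ℤ orient u v ≡ orient y x *ℤ orient v u
orient-pair-symmetric {x = x} {y} {u} {v} x≢y u≢v with compare x y | compare u v
... | equal _ e     | _             = contradiction e x≢y
... | less _ _ _    | equal _ e     = contradiction e u≢v
... | greater _ _ _ | equal _ e     = contradiction e u≢v
... | less p q _    | less r s _    rewrite p | q | r | s = refl
... | less p q _    | greater r s _ rewrite p | q | r | s = refl
... | greater p q _ | less r s _    rewrite p | q | r | s = refl
... | greater p q _ | greater r s _ rewrite p | q | r | s = refl

sgn-∏ : (f : Fin n → Fin n) → sgn f ≡ ∏₂ (λ i j → guard (lt i j) (orient (f i) (f j)))
sgn-∏ {n} f = trans (^-sumℕ -1ℤ n (λ i → sumℕ (map (λ j → inv i j) (allFin n))))
  (∏-cong (λ i → trans (^-sumℕ -1ℤ n (inv i)) (∏-cong (λ j → entry (lt i j) (lt (f j) (f i))))))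
  where
  inv : Fin n → Fin n → ℕ
  inv i j = if lt i j ∧ lt (f j) (f i) then 1 else 0
  entry : ∀ b c → -1ℤ ^ (if b ∧ c then 1 else 0) ≡ guard b (guard c -1ℤ)
  entry true  true  = refl
  entry true  false = refl
  entry false c     = refl

sgn-cong : {f g : Fin n → Fin n} → (∀ i → f i ≡ g i) → sgn f ≡ sgn g
sgn-cong {f = f} {g} eq = trans (sgn-∏ f) (trans
  (∏₂-cong (λ i j → cong₂ (λ x y → guard (lt i j) (orient x y)) (eq i) (eq j))) (sym (sgn-∏ g)))

-- A symmetric h depends on the unordered pair alone, and f permutes the unordered pairs.
∏₂-ordered-reindex : {f : Fin n → Fin n} → IsPerm f → (h : Fin n → Fin n → ℤ) →
  (∀ x y → h x y ≡ h y x) →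
  ∏₂ (λ i j → guard (lt i j) (h (f i) (f j))) ≡ ∏₂ (λ i j → guard (lt i j) (h i j))
∏₂-ordered-reindex {n} {f} inj h h-sym = begin
  ∏₂ (λ i j → guard (lt i j) (h (f i) (f j)))
    -- Pulling the comparison back along the inverse g makes the whole factor a function of (f i, f
    -- j), to which plain reindexing applies.
    ≡⟨ ∏₂-cong (λ i j → cong₂ (λ x y → guard (lt x y) (h (f i) (f j))) (sym (g∘f i)) (sym (g∘f j))) ⟩
  ∏₂ (λ i j → k (f i) (f j))
    ≡⟨ ∏₂-reindex inj inj k ⟩
  ∏₂ k
    ≡⟨ ∏₂-pairs k ⟩
  ∏₂ (λ x y → guard (lt x y) (k x y *ℤ k y x)) *ℤ ∏ (λ x → k x x)
    ≡⟨ cong₂ _*ℤ_ (∏₂-cong merge) (trans (∏-cong (λ x → cong (λ b → guard b (h x x)) (lt-irrefl (g x)))) (∏-one n)) ⟩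
  ∏₂ (λ x y → guard (lt x y) (h x y)) *ℤ 1ℤ
    ≡⟨ ℤ.*-identityʳ _ ⟩
  ∏₂ (λ x y → guard (lt x y) (h x y)) ∎
  where
  surj = injective⇒surjective inj
  g : Fin n → Fin n
  g = proj₁ ∘ surj
  g∘f : ∀ i → g (f i) ≡ i
  g∘f i = inj _ i (proj₂ (surj (f i)))
  g-injective : ∀ {x y} → g x ≡ g y → x ≡ y
  g-injective {x} {y} e = trans (sym (proj₂ (surj x))) (trans (cong f e) (proj₂ (surj y)))
  k : Fin n → Fin n → ℤ
  k x y = guard (lt (g x) (g y)) (h x y)
  merge : ∀ x y → guard (lt x y) (k x y *ℤ k y x) ≡ guard (lt x y) (h x y)
  merge x y with compare x y
  ... | equal p _     rewrite p = refl
  ... | greater p _ _ rewrite p = refl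
  ... | less p _ x≢y with compare (g x) (g y)
  ...   | less q r _    rewrite p | q | r = ℤ.*-identityʳ _
  ...   | equal _ e     = contradiction (g-injective e) x≢y
  ...   | greater q r _ rewrite p | q | r = trans (ℤ.*-identityˡ _) (h-sym y x)

-- `ε x y` records whether τ reverses the pair x, y. It is symmetric, so its product over pairs is
-- unaffected by f and equals the sign of τ.
sgn-∘ : {τ f : Fin n → Fin n} → IsPerm τ → IsPerm f → sgn (τ ∘ f) ≡ sgn τ *ℤ sgn f
sgn-∘ {n} {τ} {f} perm-τ perm-f = begin
  sgn (τ ∘ f)
    ≡⟨ sgn-∏ (τ ∘ f) ⟩
  ∏₂ (λ i j → guard (lt i j) (orient (τ (f i)) (τ (f j))))
    ≡⟨ ∏₂-cong (λ i j → trans (cong (guard (lt i j)) (factor (f i) (f j))) (guard-* (lt i j) (ε (f i) (f j)) (orient (f i) (f j)))) ⟩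
  ∏₂ (λ i j → guard (lt i j) (ε (f i) (f j)) *ℤ guard (lt i j) (orient (f i) (f j)))
    ≡⟨ ∏₂-distrib-* (λ i j → guard (lt i j) (ε (f i) (f j))) (λ i j → guard (lt i j) (orient (f i) (f j))) ⟩
  ∏₂ (λ i j → guard (lt i j) (ε (f i) (f j))) *ℤ ∏₂ (λ i j → guard (lt i j) (orient (f i) (f j)))
    ≡⟨ cong₂ _*ℤ_ (∏₂-ordered-reindex perm-f ε ε-sym) (sym (sgn-∏ f)) ⟩
  ∏₂ (λ i j → guard (lt i j) (ε i j)) *ℤ sgn f
    ≡⟨ cong (_*ℤ sgn f) (trans (∏₂-cong ordered) (sym (sgn-∏ τ))) ⟩
  sgn τ *ℤ sgn f ∎
  where
  ε : Fin n → Fin n → ℤ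
  ε x y = orient x y *ℤ orient (τ x) (τ y)
  factor : ∀ x y → orient (τ x) (τ y) ≡ ε x y *ℤ orient x y
  factor x y = begin
    orient (τ x) (τ y)                              ≡⟨ sym (ℤ.*-identityˡ _) ⟩
    1ℤ *ℤ orient (τ x) (τ y)                        ≡⟨ cong (_*ℤ orient (τ x) (τ y)) (sym (isSign-square (orient-isSign x y))) ⟩
    (orient x y *ℤ orient x y) *ℤ orient (τ x) (τ y) ≡⟨ solve 2 (λ a b → (a :* a) :* b := (a :* b) :* a) refl (orient x y) (orient (τ x) (τ y)) ⟩
    ε x y *ℤ orient x y                             ∎
  ε-sym : ∀ x y → ε x y ≡ ε y x
  ε-sym x y with x ≟ y
  ... | yes refl = refl
  ... | no x≢y   = orient-pair-symmetric x≢y (λ e → x≢y (perm-τ x y e))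
  ordered : ∀ i j → guard (lt i j) (ε i j) ≡ guard (lt i j) (orient (τ i) (τ j))
  ordered i j with compare i j
  ... | less p q _    rewrite p | q = ℤ.*-identityˡ _
  ... | equal p _     rewrite p = refl
  ... | greater p _ _ rewrite p = refl

sgn-id : sgn {n} (λ i → i) ≡ 1ℤ
sgn-id {n} = trans (sgn-∏ {n} (λ i → i)) (trans (∏₂-cong entry) (∏₂-one n))
  where
  entry : ∀ (i j : Fin n) → guard (lt i j) (orient i j) ≡ 1ℤ
  entry i j with compare i j
  ... | less p q _    rewrite p | q = refl
  ... | equal p _     rewrite p = refl
  ... | greater p _ _ rewrite p = refl

-- Equals (−1)^(n choose 2), since each unordered pair contributes −1.
Δ : ℕ → ℤ
Δ n = ∏₂ {n} orient

Δ-pairs : ∀ n → Δ n ≡ ∏₂ {n} (λ i j → guard (lt i j) -1ℤ)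
Δ-pairs n = begin
  ∏₂ {n} orient
    ≡⟨ ∏₂-pairs {n} orient ⟩
  ∏₂ {n} (λ i j → guard (lt i j) (orient i j *ℤ orient j i)) *ℤ ∏ {n} (λ i → orient i i)
    ≡⟨ cong₂ _*ℤ_ (∏₂-cong entry) (trans (∏-cong {n} orient-refl) (∏-one n)) ⟩
  ∏₂ {n} (λ i j → guard (lt i j) -1ℤ) *ℤ 1ℤ
    ≡⟨ ℤ.*-identityʳ _ ⟩
  ∏₂ {n} (λ i j → guard (lt i j) -1ℤ) ∎
  where
  entry : ∀ (i j : Fin n) → guard (lt i j) (orient i j *ℤ orient j i) ≡ guard (lt i j) -1ℤ
  entry i j with compare i j
  ... | less p q _    rewrite p | q = refl
  ... | equal p _     rewrite p = refl
  ... | greater p _ _ rewrite p = refl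

Δ-isSign : ∀ n → IsSign (Δ n)
Δ-isSign n = ∏-isSign {n} (λ i → ∏-isSign {n} (λ j → orient-isSign i j))

-- This is Δ to the power (n choose 2). If Δ is 1 it is trivial; if Δ is -1, the product is the very
-- one that `Δ-pairs` evaluates to Δ.
∏₂-ordered-Δ : ∀ n → ∏₂ {n} (λ i j → guard (lt i j) (Δ n)) ≡ Δ n
∏₂-ordered-Δ n with Δ-isSign n
... | inj₁ e = trans (∏₂-cong {n} (λ i j → trans (cong (guard (lt i j)) e) (guard-1 (lt i j)))) (trans (∏₂-one n) (sym e))
... | inj₂ e = trans (∏₂-cong {n} (λ i j → cong (guard (lt i j)) e)) (sym (Δ-pairs n))

Δ-binomial : ∀ n → Δ n ≡ -1ℤ ^ ((n * (n ∸ 1)) / 2)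
Δ-binomial n = trans (Δ-pairs n) (go n)
  where
  ∏-const : ∀ k → ∏ {k} (λ _ → -1ℤ) ≡ -1ℤ ^ k
  ∏-const zero    = refl
  ∏-const (suc k) = cong (-1ℤ *ℤ_) (∏-const k)

  triangle : ∀ k → (suc k * k) / 2 ≡ k ℕ.+ (k * (k ∸ 1)) / 2
  triangle zero    = refl
  triangle (suc k) = begin
    -- The split (k + 2)(k + 1) = 2(k + 1) + (k + 1)k has an even first summand, so the rounded
    -- division distributes over it.
    (suc (suc k) * suc k) / 2                 ≡⟨ cong (_/ 2) (ℕ-Solver.solve 1 (λ x → (con 2 :+ₙ x) :*ₙ (con 1 :+ₙ x) :=ₙ (con 1 :+ₙ x) :*ₙ con 2 :+ₙ (con 1 :+ₙ x) :*ₙ x) refl k) ⟩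
    (suc k * 2 ℕ.+ suc k * k) / 2             ≡⟨ ℕ.+-distrib-/-∣ˡ (suc k * k) (ℕ.divides (suc k) refl) ⟩
    (suc k * 2) / 2 ℕ.+ (suc k * k) / 2       ≡⟨ cong (ℕ._+ (suc k * k) / 2) (ℕ.m*n/n≡m (suc k) 2) ⟩
    suc k ℕ.+ (suc k * k) / 2                 ∎
    where open ℕ-Solver using (con) renaming (_:+_ to _:+ₙ_; _:*_ to _:*ₙ_; _:=_ to _:=ₙ_)

  go : ∀ k → ∏₂ {k} (λ i j → guard (lt i j) -1ℤ) ≡ -1ℤ ^ ((k * (k ∸ 1)) / 2)
  go zero    = refl
  go (suc k) = begin
    -- The factor at i = `zero` collects the k pairs containing `zero`; the other factors form the
    -- same product for k.
    (1ℤ *ℤ ∏ {k} (λ _ → -1ℤ)) *ℤ ∏ {k} (λ i → 1ℤ *ℤ ∏ {k} (λ j → guard (lt i j) -1ℤ))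
      ≡⟨ cong₂ _*ℤ_ (ℤ.*-identityˡ (∏ {k} (λ _ → -1ℤ))) (∏-cong {k} (λ i → ℤ.*-identityˡ (∏ {k} (λ j → guard (lt i j) -1ℤ)))) ⟩
    ∏ {k} (λ _ → -1ℤ) *ℤ ∏₂ {k} (λ i j → guard (lt i j) -1ℤ)
      ≡⟨ cong₂ _*ℤ_ (∏-const k) (go k) ⟩
    -1ℤ ^ k *ℤ -1ℤ ^ ((k * (k ∸ 1)) / 2)
      ≡⟨ sym (ℤ.^-distribˡ-+-* -1ℤ k ((k * (k ∸ 1)) / 2)) ⟩
    -1ℤ ^ (k ℕ.+ (k * (k ∸ 1)) / 2)
      ≡⟨ cong (-1ℤ ^_) (sym (triangle k)) ⟩
    -1ℤ ^ ((suc k * k) / 2) ∎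

-- The row, column and symbol signs of a Latin square

-- R is the conjugate of L whose k-th row maps each row index of L to the column holding k.
module ThreeSigns (L R : Square n) (latin : IsLatin L) (inverse : ∀ k i → L i (R k i) ≡ k) where

  private
    rows = proj₁ latin
    cols = proj₂ latin

    R-L : ∀ i j → R (L i j) i ≡ j
    R-L i j = rows i _ j (inverse (L i j) i)

    rowSign colSign symbolSign : ℤ
    rowSign    = ∏ (λ i → sgn (row L i))
    colSign    = ∏ (λ j → sgn (col L j))
    symbolSign = ∏ (λ k → sgn (R k))

    -- The factor of a pair of cells sharing neither column (x, y) nor symbol (u, v).
    generic : Fin n → Fin n → Fin n → Fin n → ℤ
    generic x y u v = if does (x ≟ y) then 1ℤ else (if does (u ≟ v) then 1ℤ else orient x y *ℤ orient u v)

    -- With this, a factor belongs to an unordered pair of cells.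
    generic-symmetric : ∀ x y u v → generic x y u v ≡ generic y x v u
    generic-symmetric x y u v with x ≟ y
    ... | yes refl rewrite ≟-refl x = refl
    ... | no x≢y with u ≟ v
    ...   | yes refl rewrite ≟-≢ (x≢y ∘ sym) | ≟-refl u = refl
    ...   | no u≢v   rewrite ≟-≢ (x≢y ∘ sym) | ≟-≢ (u≢v ∘ sym) = orient-pair-symmetric x≢y u≢v

    -- `orient` is 1 on equal arguments, so a shared column or symbol leaves just the orientation of
    -- the other coordinate.
    generic-split : ∀ x y u v → orient x y *ℤ orient u v ≡
      guard (does (x ≟ y)) (orient u v) *ℤ (guard (does (u ≟ v)) (orient x y) *ℤ generic x y u v)
    generic-split x y u v with x ≟ y | u ≟ v
    ... | yes refl | yes refl rewrite orient-refl x | orient-refl u = refl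
    ... | yes refl | no _     rewrite orient-refl x = ℤ.*-comm 1ℤ (orient u v)
    ... | no _     | yes refl rewrite orient-refl u = sym (ℤ.*-identityˡ _)
    ... | no _     | no _     = sym (trans (ℤ.*-identityˡ _) (ℤ.*-identityˡ _))

    Cell : Fin n → Fin n → Fin n → Fin n → ℤ
    Cell r r′ c c′ = generic c c′ (L r c) (L r′ c′)

    -- The product over pairs of cells with no common row, column or symbol, grouped by row pairs.
    N : ℤ
    N = ∏₂ (λ r r′ → guard (lt r r′) (∏₂ (λ c c′ → guard (lt c c′) (Cell r r′ c c′ *ℤ Cell r′ r c c′))))

    -- With r, r′ fixed, both ∏ orient c c′ and ∏ orient (L r c) (L r′ c′) are Δ n, so their
    -- product is 1; it is sorted by whether the two cells share a column, a symbol or neither.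
    row-pair-product : ∀ r r′ → ∏ (λ c → orient (L r c) (L r′ c)) *ℤ
      (∏ (λ k → orient (R k r) (R k r′)) *ℤ ∏₂ (λ c c′ → guard (lt c c′) (Cell r r′ c c′ *ℤ Cell r′ r c c′))) ≡ 1ℤ
    row-pair-product r r′ = begin
      ∏ (λ c → orient (L r c) (L r′ c)) *ℤ
        (∏ (λ k → orient (R k r) (R k r′)) *ℤ ∏₂ (λ c c′ → guard (lt c c′) (Cell r r′ c c′ *ℤ Cell r′ r c c′)))
        ≡⟨ cong (∏ (λ c → orient (L r c) (L r′ c)) *ℤ_) (cong₂ _*ℤ_ (sym symbols) (sym cells)) ⟩
      ∏ (λ c → orient (L r c) (L r′ c)) *ℤ (∏₂ sameSymbol *ℤ ∏₂ (Cell r r′))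
        ≡⟨ cong₂ _*ℤ_ (sym (∏₂-delta (λ c c′ → orient (L r c) (L r′ c′)))) (sym (∏₂-distrib-* sameSymbol (Cell r r′))) ⟩
      ∏₂ sameColumn *ℤ ∏₂ (λ c c′ → sameSymbol c c′ *ℤ Cell r r′ c c′)
        ≡⟨ sym (∏₂-distrib-* sameColumn (λ c c′ → sameSymbol c c′ *ℤ Cell r r′ c c′)) ⟩
      ∏₂ (λ c c′ → sameColumn c c′ *ℤ (sameSymbol c c′ *ℤ Cell r r′ c c′))
        ≡⟨ ∏₂-cong (λ c c′ → sym (generic-split c c′ (L r c) (L r′ c′))) ⟩
      ∏₂ (λ c c′ → orient c c′ *ℤ orient (L r c) (L r′ c′))
        ≡⟨ ∏₂-distrib-* orient (λ c c′ → orient (L r c) (L r′ c′)) ⟩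
      Δ n *ℤ ∏₂ (λ c c′ → orient (L r c) (L r′ c′))
        ≡⟨ cong (Δ n *ℤ_) (∏₂-reindex (rows r) (rows r′) orient) ⟩
      Δ n *ℤ Δ n
        ≡⟨ isSign-square (Δ-isSign n) ⟩
      1ℤ ∎
      where
      sameColumn sameSymbol : Fin n → Fin n → ℤ
      sameColumn c c′ = guard (does (c ≟ c′)) (orient (L r c) (L r′ c′))
      sameSymbol c c′ = guard (does (L r c ≟ L r′ c′)) (orient c c′)

      -- Row r′ holds the symbol `L r c` in exactly one column, so the guard becomes a delta in c′.
      eq-symbol : ∀ c c′ → does (L r c ≟ L r′ c′) ≡ does (R (L r c) r′ ≟ c′)
      eq-symbol c c′ with R (L r c) r′ ≟ c′
      ... | yes refl = dec-true (L r c ≟ L r′ (R (L r c) r′)) (sym (inverse (L r c) r′))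
      ... | no ne    = dec-false (L r c ≟ L r′ c′) (λ e → ne (trans (cong (λ k → R k r′) e) (R-L r′ c′)))

      symbols : ∏₂ sameSymbol ≡ ∏ (λ k → orient (R k r) (R k r′))
      symbols = begin
        ∏₂ sameSymbol
          ≡⟨ ∏₂-cong (λ c c′ → cong (λ b → guard b (orient c c′)) (eq-symbol c c′)) ⟩
        ∏₂ (λ c c′ → guard (does (R (L r c) r′ ≟ c′)) (orient c c′))
          ≡⟨ ∏-cong (λ c → ∏-delta (R (L r c) r′) (orient c)) ⟩
        ∏ (λ c → orient c (R (L r c) r′))
          -- Writing c as `R (L r c) r` makes the factor a function of the symbol `L r c`, and row r
          -- runs through every symbol once.
          ≡⟨ ∏-cong (λ c → cong (λ x → orient x (R (L r c) r′)) (sym (R-L r c))) ⟩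
        ∏ (λ c → orient (R (L r c) r) (R (L r c) r′))
          ≡⟨ ∏-reindex (rows r) (λ k → orient (R k r) (R k r′)) ⟩
        ∏ (λ k → orient (R k r) (R k r′)) ∎

      diagonal : ∀ c → Cell r r′ c c ≡ 1ℤ
      diagonal c rewrite ≟-refl c = refl

      cells : ∏₂ (Cell r r′) ≡ ∏₂ (λ c c′ → guard (lt c c′) (Cell r r′ c c′ *ℤ Cell r′ r c c′))
      cells = begin
        ∏₂ (Cell r r′)
          ≡⟨ ∏₂-pairs (Cell r r′) ⟩
        ∏₂ (λ c c′ → guard (lt c c′) (Cell r r′ c c′ *ℤ Cell r r′ c′ c)) *ℤ ∏ (λ c → Cell r r′ c c)
          ≡⟨ cong₂ _*ℤ_
               (∏₂-cong (λ c c′ → cong (λ x → guard (lt c c′) (Cell r r′ c c′ *ℤ x)) (generic-symmetric c′ c (L r c′) (L r′ c))))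
               (trans (∏-cong (λ c → diagonal c)) (∏-one n)) ⟩
        ∏₂ (λ c c′ → guard (lt c c′) (Cell r r′ c c′ *ℤ Cell r′ r c c′)) *ℤ 1ℤ
          ≡⟨ ℤ.*-identityʳ _ ⟩
        ∏₂ (λ c c′ → guard (lt c c′) (Cell r r′ c c′ *ℤ Cell r′ r c c′)) ∎

    -- Columns of L and rows of R are both functions of the row index, so all three factors are
    -- products over r < r′ and combine pair by pair.
    col-symbol-N : colSign *ℤ (symbolSign *ℤ N) ≡ 1ℤ
    col-symbol-N = begin
      colSign *ℤ (symbolSign *ℤ N)
        ≡⟨ cong₂ (λ x y → x *ℤ (y *ℤ N))
             (trans (∏-cong (λ c → sgn-∏ (col L c))) (∏-∏₂-guard-comm lt (λ c r r′ → orient (L r c) (L r′ c))))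
             (trans (∏-cong (λ k → sgn-∏ (R k))) (∏-∏₂-guard-comm lt (λ k r r′ → orient (R k r) (R k r′)))) ⟩
      ∏₂ (λ r r′ → guard (lt r r′) (a r r′)) *ℤ (∏₂ (λ r r′ → guard (lt r r′) (b r r′)) *ℤ ∏₂ (λ r r′ → guard (lt r r′) (c r r′)))
        ≡⟨ cong (∏₂ (λ r r′ → guard (lt r r′) (a r r′)) *ℤ_) (sym (guarded b c)) ⟩
      ∏₂ (λ r r′ → guard (lt r r′) (a r r′)) *ℤ ∏₂ (λ r r′ → guard (lt r r′) (b r r′ *ℤ c r r′))
        ≡⟨ sym (guarded a (λ r r′ → b r r′ *ℤ c r r′)) ⟩
      ∏₂ (λ r r′ → guard (lt r r′) (a r r′ *ℤ (b r r′ *ℤ c r r′)))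
        ≡⟨ ∏₂-cong (λ r r′ → trans (cong (guard (lt r r′)) (row-pair-product r r′)) (guard-1 (lt r r′))) ⟩
      ∏₂ {n} (λ r r′ → 1ℤ)
        ≡⟨ ∏₂-one n ⟩
      1ℤ ∎
      where
      a b c : Fin n → Fin n → ℤ
      a r r′ = ∏ (λ c → orient (L r c) (L r′ c))
      b r r′ = ∏ (λ k → orient (R k r) (R k r′))
      c r r′ = ∏₂ (λ c c′ → guard (lt c c′) (Cell r r′ c c′ *ℤ Cell r′ r c c′))
      guarded : (k l : Fin n → Fin n → ℤ) → ∏₂ (λ r r′ → guard (lt r r′) (k r r′ *ℤ l r r′)) ≡
        ∏₂ (λ r r′ → guard (lt r r′) (k r r′)) *ℤ ∏₂ (λ r r′ → guard (lt r r′) (l r r′))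
      guarded k l = trans (∏₂-cong (λ r r′ → guard-* (lt r r′) (k r r′) (l r r′)))
        (∏₂-distrib-* (λ r r′ → guard (lt r r′) (k r r′)) (λ r r′ → guard (lt r r′) (l r r′)))

    -- For c < c′ the factor `orient c c′` is 1, so every cell factor is `orient (L r c) (L r′ c′)`,
    -- also for equal symbols. The row sign contributes the missing terms r = r′, and both columns
    -- are permutations, so the full product is one copy of Δ.
    column-pair-product : ∀ c c′ → lt c c′ ≡ true → lt c′ c ≡ false → c ≢ c′ →
      ∏ (λ r → orient (L r c) (L r c′)) *ℤ ∏₂ (λ r r′ → guard (lt r r′) (Cell r r′ c c′ *ℤ Cell r′ r c c′)) ≡ Δ n
    column-pair-product c c′ c<c′ c′≮c c≢c′ = begin
      ∏ (λ r → orient (L r c) (L r c′)) *ℤ ∏₂ (λ r r′ → guard (lt r r′) (Cell r r′ c c′ *ℤ Cell r′ r c c′))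
        ≡⟨ cong₂ _*ℤ_ (sym (∏₂-delta (λ r r′ → orient (L r c) (L r′ c′)))) (sym cells) ⟩
      ∏₂ sameRow *ℤ ∏₂ offRow
        ≡⟨ sym (∏₂-distrib-* sameRow offRow) ⟩
      ∏₂ (λ r r′ → sameRow r r′ *ℤ offRow r r′)
        ≡⟨ ∏₂-cong split ⟩
      ∏₂ (λ r r′ → orient (L r c) (L r′ c′))
        ≡⟨ ∏₂-reindex (cols c) (cols c′) orient ⟩
      Δ n ∎
      where
      sameRow offRow : Fin n → Fin n → ℤ
      sameRow r r′ = guard (does (r ≟ r′)) (orient (L r c) (L r′ c′))
      offRow  r r′ = guard (not (does (r ≟ r′))) (Cell r r′ c c′)

      cell-orient : ∀ r r′ → Cell r r′ c c′ ≡ orient (L r c) (L r′ c′)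
      cell-orient r r′ rewrite ≟-≢ c≢c′ | c′≮c with L r c ≟ L r′ c′
      ... | yes e = trans (sym (orient-refl (L r c))) (cong (orient (L r c)) e)
      ... | no _  = ℤ.*-identityˡ _

      split : ∀ r r′ → sameRow r r′ *ℤ offRow r r′ ≡ orient (L r c) (L r′ c′)
      split r r′ with does (r ≟ r′)
      ... | true  = ℤ.*-identityʳ _
      ... | false = trans (ℤ.*-identityˡ _) (cell-orient r r′)

      off-pairs : ∀ r r′ → guard (lt r r′) (offRow r r′ *ℤ offRow r′ r) ≡ guard (lt r r′) (Cell r r′ c c′ *ℤ Cell r′ r c c′)
      off-pairs r r′ with compare r r′
      ... | less p _ r≢r′ rewrite p | ≟-≢ r≢r′ | ≟-≢ (r≢r′ ∘ sym) = refl
      ... | equal p _     rewrite p = refl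
      ... | greater p _ _ rewrite p = refl

      cells : ∏₂ offRow ≡ ∏₂ (λ r r′ → guard (lt r r′) (Cell r r′ c c′ *ℤ Cell r′ r c c′))
      cells = begin
        ∏₂ offRow
          ≡⟨ ∏₂-pairs offRow ⟩
        ∏₂ (λ r r′ → guard (lt r r′) (offRow r r′ *ℤ offRow r′ r)) *ℤ ∏ (λ r → offRow r r)
          ≡⟨ cong₂ _*ℤ_ (∏₂-cong off-pairs)
               (trans (∏-cong (λ r → cong (λ b → guard (not b) (Cell r r c c′)) (≟-refl r))) (∏-one n)) ⟩
        ∏₂ (λ r r′ → guard (lt r r′) (Cell r r′ c c′ *ℤ Cell r′ r c c′)) *ℤ 1ℤ
          ≡⟨ ℤ.*-identityʳ _ ⟩
        ∏₂ (λ r r′ → guard (lt r r′) (Cell r r′ c c′ *ℤ Cell r′ r c c′)) ∎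

    -- The product N is read by column pairs; each pair c < c′ absorbs its share of the row signs
    -- and yields Δ.
    row-N : rowSign *ℤ N ≡ Δ n
    row-N = begin
      rowSign *ℤ N
        ≡⟨ cong₂ _*ℤ_
             (trans (∏-cong (λ r → sgn-∏ (row L r))) (∏-∏₂-guard-comm lt (λ r c c′ → orient (L r c) (L r c′))))
             (∏₂-∏₂-guard-comm lt lt (λ r r′ c c′ → Cell r r′ c c′ *ℤ Cell r′ r c c′)) ⟩
      ∏₂ (λ c c′ → guard (lt c c′) (a c c′)) *ℤ ∏₂ (λ c c′ → guard (lt c c′) (b c c′))
        ≡⟨ sym (∏₂-distrib-* (λ c c′ → guard (lt c c′) (a c c′)) (λ c c′ → guard (lt c c′) (b c c′))) ⟩
      ∏₂ (λ c c′ → guard (lt c c′) (a c c′) *ℤ guard (lt c c′) (b c c′))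
        ≡⟨ ∏₂-cong (λ c c′ → sym (guard-* (lt c c′) (a c c′) (b c c′))) ⟩
      ∏₂ (λ c c′ → guard (lt c c′) (a c c′ *ℤ b c c′))
        ≡⟨ ∏₂-cong entry ⟩
      ∏₂ {n} (λ c c′ → guard (lt c c′) (Δ n))
        ≡⟨ ∏₂-ordered-Δ n ⟩
      Δ n ∎
      where
      a b : Fin n → Fin n → ℤ
      a c c′ = ∏ (λ r → orient (L r c) (L r c′))
      b c c′ = ∏₂ (λ r r′ → guard (lt r r′) (Cell r r′ c c′ *ℤ Cell r′ r c c′))
      entry : ∀ c c′ → guard (lt c c′) (a c c′ *ℤ b c c′) ≡ guard (lt c c′) (Δ n)
      entry c c′ with compare c c′
      ... | equal p _      rewrite p = refl
      ... | greater p _ _  rewrite p = refl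
      ... | less p q c≢c′  = cong (guard (lt c c′)) (column-pair-product c c′ p q c≢c′)

  -- With signs r, c, s the two groupings say c s N = 1 and r N = Δ. Signs are their own inverses,
  -- so eliminating N gives s = Δ r c.
  symbolSign-sgnSquare : ∏ (λ k → sgn (R k)) ≡ Δ n *ℤ sgnSquare L
  symbolSign-sgnSquare = begin
    s                                       ≡⟨ sym (trans (cong₂ (λ x y → s *ℤ x *ℤ y) (isSign-square r-sign) (isSign-square c-sign)) (trans (ℤ.*-identityʳ _) (ℤ.*-identityʳ _))) ⟩
    s *ℤ (r *ℤ r) *ℤ (c *ℤ c)               ≡⟨ sym (ℤ.*-identityʳ _) ⟩
    s *ℤ (r *ℤ r) *ℤ (c *ℤ c) *ℤ 1ℤ         ≡⟨ cong (s *ℤ (r *ℤ r) *ℤ (c *ℤ c) *ℤ_) (sym col-symbol-N) ⟩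
    s *ℤ (r *ℤ r) *ℤ (c *ℤ c) *ℤ (c *ℤ (s *ℤ N))
      ≡⟨ solve 4 (λ s r c N → s :* (r :* r) :* (c :* c) :* (c :* (s :* N)) := (s :* s) :* (c :* c) :* ((r :* N) :* (r :* c))) refl s r c N ⟩
    (s *ℤ s) *ℤ (c *ℤ c) *ℤ ((r *ℤ N) *ℤ (r *ℤ c))
      ≡⟨ cong₂ (λ x y → x *ℤ y *ℤ ((r *ℤ N) *ℤ (r *ℤ c))) (isSign-square s-sign) (isSign-square c-sign) ⟩
    1ℤ *ℤ ((r *ℤ N) *ℤ (r *ℤ c))            ≡⟨ ℤ.*-identityˡ _ ⟩
    (r *ℤ N) *ℤ (r *ℤ c)                    ≡⟨ cong₂ _*ℤ_ row-N (sym (cong₂ _*ℤ_ (prodℤ-∏ n (λ i → sgn (row L i))) (prodℤ-∏ n (λ j → sgn (col L j))))) ⟩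
    Δ n *ℤ sgnSquare L                      ∎
    where
    r = rowSign
    c = colSign
    s = symbolSign
    r-sign = ∏-isSign (λ i → sgn-isSign (row L i))
    c-sign = ∏-isSign (λ j → sgn-isSign (col L j))
    s-sign = ∏-isSign (λ k → sgn-isSign (R k))

-- Reindexing the sum over Latin squares

-- The default value j is never taken when f is injective.
inv : (Fin n → Fin n) → Fin n → Fin n
inv f j with any? (λ i → f i ≟ j)
... | yes (i , _) = i
... | no _        = j

inv-right : {f : Fin n → Fin n} → IsPerm f → ∀ j → f (inv f j) ≡ j
inv-right {f = f} perm j with any? (λ i → f i ≟ j)
... | yes (_ , e) = e
... | no miss     = contradiction (injective⇒surjective perm j) miss

inv-left : {f : Fin n → Fin n} → IsPerm f → ∀ i → inv f (f i) ≡ i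
inv-left {f = f} perm i = perm _ i (inv-right perm (f i))

inv-perm : {f : Fin n → Fin n} → IsPerm f → IsPerm (inv f)
inv-perm {f = f} perm j j′ e = trans (sym (inv-right perm j)) (trans (cong f e) (inv-right perm j′))

funs : ∀ n → Enumerated (Fin n → Fin n)
funs n = funEnum n (finEnum n)

squares : ∀ n → Enumerated (Square n)
squares n = funEnum n (funs n)

∑-const : ∀ n c → ∑ (allFin n) (λ _ → c) ≡ + n *ℤ c
∑-const zero    c = refl
∑-const (suc n) c = begin
  ∑ (allFin (suc n)) (λ _ → c)     ≡⟨ ∑-allFin-suc n (λ _ → c) ⟩
  c +ℤ ∑ (allFin n) (λ _ → c)      ≡⟨ cong (c +ℤ_) (∑-const n c) ⟩
  c +ℤ + n *ℤ c                    ≡⟨ sym (ℤ.suc-* (+ n) c) ⟩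
  + suc n *ℤ c                     ∎

-- `∑-fibres` leaves the fibre condition C outside the constraint P; merging them lets a single
-- fibre be reindexed.
∑-fibre-reindex : ∀ (EA : Enumerated A) (EB : Enumerated B) {C P : A → Set} {Q : B → Set}
  (C? : ∀ a → Dec (C a)) (P? : ∀ a → Dec (P a)) (Q? : ∀ b → Dec (Q b)) (F : A → ℤ) (G : B → ℤ) (φ : A → B) (ψ : B → A) →
  let module A = Enumerated EA; module B = Enumerated EB in
  (∀ a b → C a × P a → b B.≈ φ a → Q b × a A.≈ ψ b × F a ≡ G b) →
  (∀ a b → Q b → a A.≈ ψ b → (C a × P a) × b B.≈ φ a) →
  ∑ A.elements (λ a → ⟦ C? a ⟧ *ℤ (⟦ P? a ⟧ *ℤ F a)) ≡ ∑ B.elements (λ b → ⟦ Q? b ⟧ *ℤ G b)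
∑-fibre-reindex EA EB C? P? Q? F G φ ψ to from = trans
  (∑-cong A.elements (λ a → trans (sym (ℤ.*-assoc ⟦ C? a ⟧ ⟦ P? a ⟧ (F a)))
    (cong (_*ℤ F a) (sym (⟦⟧-× (C? a) (P? a))))))
  (∑-reindex EA EB (λ a → C? a ×-dec P? a) Q? F G φ ψ to from)
  where module A = Enumerated EA

∑-fibre-empty : ∀ (xs : List A) {C P : A → Set} (C? : ∀ a → Dec (C a)) (P? : ∀ a → Dec (P a)) (F : A → ℤ) →
  (∀ a → C a → ¬ P a) → ∑ xs (λ a → ⟦ C? a ⟧ *ℤ (⟦ P? a ⟧ *ℤ F a)) ≡ 0ℤ
∑-fibre-empty xs C? P? F disjoint = trans
  (∑-cong xs (λ a → trans
    (⟦⟧*-cong (C? a) (λ c → cong (_*ℤ F a) (⟦⟧-false (P? a) (disjoint a c))))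
    (ℤ.*-zeroʳ ⟦ C? a ⟧)))
  (∑-zero xs)

-- Counting permutations

fixesZero? : ∀ {m} (ρ : Fin (suc m) → Fin (suc m)) → Dec (IsPerm ρ × ρ zero ≡ zero)
fixesZero? ρ = isPerm? ρ ×-dec (ρ zero ≟ zero)

∑⟦⟧*1 : ∀ (xs : List A) {P : A → Set} (P? : ∀ a → Dec (P a)) → ∑ xs (λ a → ⟦ P? a ⟧) ≡ ∑ xs (λ a → ⟦ P? a ⟧ *ℤ 1ℤ)
∑⟦⟧*1 xs P? = ∑-cong xs (λ a → sym (ℤ.*-identityʳ ⟦ P? a ⟧))

count-fixing-zero : ∀ m →
  ∑ (Enumerated.elements (funs (suc m))) (λ ρ → ⟦ fixesZero? ρ ⟧) ≡ ∑ (Enumerated.elements (funs m)) (λ σ → ⟦ isPerm? σ ⟧)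
count-fixing-zero m = trans (∑⟦⟧*1 (Enumerated.elements (funs (suc m))) fixesZero?) (trans
  (∑-reindex (funs (suc m)) (funs m) fixesZero? isPerm? (λ _ → 1ℤ) (λ _ → 1ℤ) restrict extend to from)
  (sym (∑⟦⟧*1 (Enumerated.elements (funs m)) isPerm?)))
  where
  -- The default d stands for the value `zero`, which `ρ (suc i)` never takes when ρ is injective
  -- and fixes `zero`.
  predOr : Fin m → Fin (suc m) → Fin m
  predOr d zero    = d
  predOr d (suc x) = x

  restrict : (Fin (suc m) → Fin (suc m)) → Fin m → Fin m
  restrict ρ i = predOr i (ρ (suc i))

  extend : (Fin m → Fin m) → Fin (suc m) → Fin (suc m)
  extend σ zero    = zero
  extend σ (suc i) = suc (σ i)

  suc-predOr : ∀ d x → x ≢ zero → x ≡ suc (predOr d x)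
  suc-predOr d zero    x≢0 = contradiction refl x≢0
  suc-predOr d (suc x) x≢0 = refl

  to : ∀ ρ σ → IsPerm ρ × ρ zero ≡ zero → (∀ i → σ i ≡ restrict ρ i) → IsPerm σ × (∀ i → ρ i ≡ extend σ i) × 1ℤ ≡ 1ℤ
  to ρ σ (perm , ρ0≡0) σ≈ = σ-perm , (λ { zero → ρ0≡0 ; (suc i) → ρ-suc i }) , refl
    where
    ρ-suc : ∀ i → ρ (suc i) ≡ suc (σ i)
    ρ-suc i = trans
      (suc-predOr i (ρ (suc i)) (λ e → contradiction (perm (suc i) zero (trans e (sym ρ0≡0))) (λ ())))
      (cong suc (sym (σ≈ i)))
    σ-perm : IsPerm σ
    σ-perm i i′ e = suc-injective (perm (suc i) (suc i′) (trans (ρ-suc i) (trans (cong suc e) (sym (ρ-suc i′)))))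

  from : ∀ ρ σ → IsPerm σ → (∀ i → ρ i ≡ extend σ i) → (IsPerm ρ × ρ zero ≡ zero) × (∀ i → σ i ≡ restrict ρ i)
  from ρ σ perm ρ≈ = (ρ-perm , ρ≈ zero) , λ i → sym (cong (predOr i) (ρ≈ (suc i)))
    where
    extend-perm : IsPerm (extend σ)
    extend-perm zero    zero     e = refl
    extend-perm (suc i) (suc i′) e = cong suc (perm i i′ (suc-injective e))
    ρ-perm : IsPerm ρ
    ρ-perm i i′ e = extend-perm i i′ (trans (sym (ρ≈ i)) (trans e (ρ≈ i′)))

∘-perm : {f g : Fin n → Fin n} → IsPerm f → IsPerm g → IsPerm (f ∘ g)
∘-perm {g = g} perm-f perm-g i j e = perm-g i j (perm-f (g i) (g j) e)

perm-resp : {f g : Fin n → Fin n} → (∀ i → f i ≡ g i) → IsPerm f → IsPerm g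
perm-resp eq perm i j e = perm i j (trans (eq i) (trans e (sym (eq j))))

transpose-first : ∀ (i j : Fin n) → transpose i j i ≡ j
transpose-first i j rewrite dec-true (i ≟ i) refl = refl

transpose-perm : ∀ (i j : Fin n) → IsPerm (transpose i j)
transpose-perm i j x y e = trans (sym (transpose-inverse j i)) (trans (cong (transpose j i) e) (transpose-inverse j i))

-- Split by the value v at `zero`: composing with the transposition of v and `zero` carries each of
-- the `suc m` fibres onto the permutations fixing `zero`.
count-perms-suc : ∀ m → ∑ (Enumerated.elements (funs (suc m))) (λ τ → ⟦ isPerm? τ ⟧) ≡
  + suc m *ℤ ∑ (Enumerated.elements (funs (suc m))) (λ ρ → ⟦ fixesZero? ρ ⟧)
count-perms-suc m = begin
  ∑ xs (λ τ → ⟦ isPerm? τ ⟧)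
    ≡⟨ ∑⟦⟧*1 xs isPerm? ⟩
  ∑ xs (λ τ → ⟦ isPerm? τ ⟧ *ℤ 1ℤ)
    ≡⟨ ∑-fibres (finEnum (suc m)) xs (λ τ → τ zero) (λ τ → ⟦ isPerm? τ ⟧ *ℤ 1ℤ) ⟩
  ∑ (allFin (suc m)) (λ v → ∑ xs (λ τ → ⟦ v ≟ τ zero ⟧ *ℤ (⟦ isPerm? τ ⟧ *ℤ 1ℤ)))
    ≡⟨ ∑-cong (allFin (suc m)) (λ v → trans
         (∑-fibre-reindex (funs (suc m)) (funs (suc m)) (λ τ → v ≟ τ zero) isPerm? fixesZero? (λ _ → 1ℤ) (λ _ → 1ℤ)
           (transpose v zero ∘_) (transpose zero v ∘_) (to v) (from v))
         (sym (∑⟦⟧*1 xs fixesZero?))) ⟩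
  ∑ (allFin (suc m)) (λ v → ∑ xs (λ ρ → ⟦ fixesZero? ρ ⟧))
    ≡⟨ ∑-const (suc m) _ ⟩
  + suc m *ℤ ∑ xs (λ ρ → ⟦ fixesZero? ρ ⟧) ∎
  where
  xs = Enumerated.elements (funs (suc m))

  to : ∀ v τ ρ → v ≡ τ zero × IsPerm τ → (∀ i → ρ i ≡ transpose v zero (τ i)) →
    (IsPerm ρ × ρ zero ≡ zero) × (∀ i → τ i ≡ transpose zero v (ρ i)) × 1ℤ ≡ 1ℤ
  to v τ ρ (refl , perm) ρ≈ =
      (perm-resp (λ i → sym (ρ≈ i)) (∘-perm (transpose-perm v zero) perm) , trans (ρ≈ zero) (transpose-first v zero))
    , (λ i → trans (sym (transpose-inverse zero v)) (cong (transpose zero v) (sym (ρ≈ i))))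
    , refl

  from : ∀ v τ ρ → IsPerm ρ × ρ zero ≡ zero → (∀ i → τ i ≡ transpose zero v (ρ i)) →
    (v ≡ τ zero × IsPerm τ) × (∀ i → ρ i ≡ transpose v zero (τ i))
  from v τ ρ (perm , ρ0≡0) τ≈ =
      ( sym (trans (τ≈ zero) (trans (cong (transpose zero v) ρ0≡0) (transpose-first zero v)))
      , perm-resp (λ i → sym (τ≈ i)) (∘-perm (transpose-perm zero v) perm))
    , (λ i → trans (sym (transpose-inverse v zero)) (cong (transpose v zero) (sym (τ≈ i))))

count-perms : ∀ n → ∑ (Enumerated.elements (funs n)) (λ τ → ⟦ isPerm? τ ⟧) ≡ + (n !)
count-perms zero    = refl
count-perms (suc m) = begin
  ∑ (Enumerated.elements (funs (suc m))) (λ τ → ⟦ isPerm? τ ⟧)                   ≡⟨ count-perms-suc m ⟩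
  + suc m *ℤ ∑ (Enumerated.elements (funs (suc m))) (λ ρ → ⟦ fixesZero? ρ ⟧)     ≡⟨ cong (+ suc m *ℤ_) (trans (count-fixing-zero m) (count-perms m)) ⟩
  + suc m *ℤ + (m !)                                                             ≡⟨ sym (ℤ.pos-* (suc m) (m !)) ⟩
  + (suc m !)                                                                    ∎

-- As `suc m` is odd, m is even and the factors cancel in twos.
∏-const-even : ∀ m {s} → suc m % 2 ≡ 1 → IsSign s → ∏ {m} (λ _ → s) ≡ 1ℤ
∏-const-even zero          odd s-sign = refl
∏-const-even (suc (suc m)) {s} odd s-sign = begin
  s *ℤ (s *ℤ ∏ {m} (λ _ → s))  ≡⟨ sym (ℤ.*-assoc s s _) ⟩
  (s *ℤ s) *ℤ ∏ {m} (λ _ → s)  ≡⟨ cong₂ _*ℤ_ (isSign-square s-sign) (∏-const-even m odd s-sign) ⟩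
  1ℤ                           ∎

-- Normalizing rows and columns, and passing to the conjugate square

rowSigns : Square n → ℤ
rowSigns R = ∏ (λ k → sgn (R k))

module _ (m : ℕ) where

  FirstRowId Reduced : Square (suc m) → Set
  FirstRowId R = IsLatin R × (∀ i → R zero i ≡ i)
  Reduced    R = FirstRowId R × (∀ k → R k zero ≡ k)

  firstRowId? : ∀ R → Dec (FirstRowId R)
  firstRowId? R = isLatin? R ×-dec all? (λ i → R zero i ≟ i)

  reduced? : ∀ R → Dec (Reduced R)
  reduced? R = firstRowId? R ×-dec all? (λ k → R k zero ≟ k)

  -- The fibre over a first row τ is empty unless τ is a permutation; otherwise composing every row
  -- with the inverse of τ carries it onto the squares with identity first row.
  ∑-normalize-row : suc m % 2 ≡ 1 →
    ∑ (allSquares (suc m)) (λ R → ⟦ isLatin? R ⟧ *ℤ ∏ (λ k → sgn (R (suc k)))) ≡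
    + (suc m !) *ℤ ∑ (allSquares (suc m)) (λ R → ⟦ firstRowId? R ⟧ *ℤ rowSigns R)
  ∑-normalize-row odd = begin
    ∑ (allSquares (suc m)) (λ R → ⟦ isLatin? R ⟧ *ℤ w R)
      ≡⟨ ∑-fibres (funs (suc m)) (allSquares (suc m)) (λ R → R zero) (λ R → ⟦ isLatin? R ⟧ *ℤ w R) ⟩
    ∑ F.elements (λ τ → ∑ (allSquares (suc m)) (λ R → ⟦ τ F.≈? R zero ⟧ *ℤ (⟦ isLatin? R ⟧ *ℤ w R)))
      ≡⟨ ∑-cong F.elements fibre ⟩
    ∑ F.elements (λ τ → ⟦ isPerm? τ ⟧ *ℤ S)
      ≡⟨ sym (∑-distribʳ-* F.elements S (λ τ → ⟦ isPerm? τ ⟧)) ⟩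
    ∑ F.elements (λ τ → ⟦ isPerm? τ ⟧) *ℤ S
      ≡⟨ cong (_*ℤ S) (count-perms (suc m)) ⟩
    + (suc m !) *ℤ S ∎
    where
    module F = Enumerated (funs (suc m))

    w : Square (suc m) → ℤ
    w R = ∏ (λ k → sgn (R (suc k)))

    S : ℤ
    S = ∑ (allSquares (suc m)) (λ R → ⟦ firstRowId? R ⟧ *ℤ rowSigns R)

    module _ (τ : Fin (suc m) → Fin (suc m)) (perm : IsPerm τ) where

      weight : ∀ R R′ → (∀ k i → R k i ≡ τ (R′ k i)) → (∀ k → IsPerm (R′ k)) → (∀ i → R′ zero i ≡ i) → w R ≡ rowSigns R′
      weight R R′ R≈ rows′ first = begin
        ∏ (λ k → sgn (R (suc k)))
          ≡⟨ ∏-cong (λ k → trans (sgn-cong (R≈ (suc k))) (sgn-∘ perm (rows′ (suc k)))) ⟩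
        ∏ (λ k → sgn τ *ℤ sgn (R′ (suc k)))
          ≡⟨ ∏-distrib-* {m} (λ _ → sgn τ) (λ k → sgn (R′ (suc k))) ⟩
        ∏ {m} (λ _ → sgn τ) *ℤ w R′
          -- The m copies of `sgn τ` multiply to 1, which is also the sign of the identity row
          -- `zero`; that row completes the product.
          ≡⟨ cong (_*ℤ w R′) (trans (∏-const-even m odd (sgn-isSign τ)) (sym (trans (sgn-cong first) (sgn-id {suc m})))) ⟩
        sgn (R′ zero) *ℤ w R′ ∎

      to : ∀ R R′ → (∀ i → τ i ≡ R zero i) × IsLatin R → (∀ k i → R′ k i ≡ inv τ (R k i)) →
        FirstRowId R′ × (∀ k i → R k i ≡ τ (R′ k i)) × w R ≡ rowSigns R′
      to R R′ (first , rows , cols) R′≈ = ((rows′ , cols′) , first′) , R≈ , weight R R′ R≈ rows′ first′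
        where
        rows′ : ∀ k → IsPerm (R′ k)
        rows′ k = perm-resp (λ i → sym (R′≈ k i)) (∘-perm (inv-perm perm) (rows k))
        cols′ : ∀ i → IsPerm (λ k → R′ k i)
        cols′ i = perm-resp (λ k → sym (R′≈ k i)) (∘-perm (inv-perm perm) (cols i))
        first′ : ∀ i → R′ zero i ≡ i
        first′ i = trans (R′≈ zero i) (trans (cong (inv τ) (sym (first i))) (inv-left perm i))
        R≈ : ∀ k i → R k i ≡ τ (R′ k i)
        R≈ k i = sym (trans (cong τ (R′≈ k i)) (inv-right perm (R k i)))

      from : ∀ R R′ → FirstRowId R′ → (∀ k i → R k i ≡ τ (R′ k i)) →
        ((∀ i → τ i ≡ R zero i) × IsLatin R) × (∀ k i → R′ k i ≡ inv τ (R k i))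
      from R R′ ((rows′ , cols′) , first′) R≈ =
          ( (λ i → sym (trans (R≈ zero i) (cong τ (first′ i))))
          , (λ k → perm-resp (λ i → sym (R≈ k i)) (∘-perm perm (rows′ k)))
          , (λ i → perm-resp (λ k → sym (R≈ k i)) (∘-perm perm (cols′ i))))
        , (λ k i → trans (sym (inv-left perm (R′ k i))) (cong (inv τ) (sym (R≈ k i))))

    fibre : ∀ τ → ∑ (allSquares (suc m)) (λ R → ⟦ τ F.≈? R zero ⟧ *ℤ (⟦ isLatin? R ⟧ *ℤ w R)) ≡ ⟦ isPerm? τ ⟧ *ℤ S
    fibre τ = byCases (isPerm? τ)
      where
      byCases : (d : Dec (IsPerm τ)) →
        ∑ (allSquares (suc m)) (λ R → ⟦ τ F.≈? R zero ⟧ *ℤ (⟦ isLatin? R ⟧ *ℤ w R)) ≡ ⟦ d ⟧ *ℤ S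
      byCases (yes perm) = trans
        (∑-fibre-reindex (squares (suc m)) (squares (suc m)) (λ R → τ F.≈? R zero) isLatin? firstRowId? w rowSigns
          (λ R k i → inv τ (R k i)) (λ R k i → τ (R k i)) (to τ perm) (from τ perm))
        (sym (ℤ.*-identityˡ S))
      byCases (no ¬perm) = ∑-fibre-empty (allSquares (suc m)) (λ R → τ F.≈? R zero) isLatin? w
        (λ R first (rows , _) → ¬perm (perm-resp (λ i → sym (first i)) (rows zero)))

  -- Split by the first column ρ. The identity first row forces ρ to fix `zero`, which leaves m!
  -- fibres; sorting the rows by ρ merely permutes the factors of the weight.
  ∑-normalize-column :
    ∑ (allSquares (suc m)) (λ R → ⟦ firstRowId? R ⟧ *ℤ rowSigns R) ≡
    + (m !) *ℤ ∑ (allSquares (suc m)) (λ R → ⟦ reduced? R ⟧ *ℤ rowSigns R)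
  ∑-normalize-column = begin
    ∑ (allSquares (suc m)) (λ R → ⟦ firstRowId? R ⟧ *ℤ rowSigns R)
      ≡⟨ ∑-fibres (funs (suc m)) (allSquares (suc m)) (λ R k → R k zero) (λ R → ⟦ firstRowId? R ⟧ *ℤ rowSigns R) ⟩
    ∑ F.elements (λ ρ → ∑ (allSquares (suc m)) (λ R → ⟦ ρ F.≈? (λ k → R k zero) ⟧ *ℤ (⟦ firstRowId? R ⟧ *ℤ rowSigns R)))
      ≡⟨ ∑-cong F.elements fibre ⟩
    ∑ F.elements (λ ρ → ⟦ fixesZero? ρ ⟧ *ℤ S)
      ≡⟨ sym (∑-distribʳ-* F.elements S (λ ρ → ⟦ fixesZero? ρ ⟧)) ⟩
    ∑ F.elements (λ ρ → ⟦ fixesZero? ρ ⟧) *ℤ S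
      ≡⟨ cong (_*ℤ S) (trans (count-fixing-zero m) (count-perms m)) ⟩
    + (m !) *ℤ S ∎
    where
    module F = Enumerated (funs (suc m))

    S : ℤ
    S = ∑ (allSquares (suc m)) (λ R → ⟦ reduced? R ⟧ *ℤ rowSigns R)

    module _ (ρ : Fin (suc m) → Fin (suc m)) (perm : IsPerm ρ) (ρ0≡0 : ρ zero ≡ zero) where

      to : ∀ R R′ → (∀ k → ρ k ≡ R k zero) × FirstRowId R → (∀ k i → R′ k i ≡ R (inv ρ k) i) →
        Reduced R′ × (∀ k i → R k i ≡ R′ (ρ k) i) × rowSigns R ≡ rowSigns R′
      to R R′ (first , (rows , cols) , row0) R′≈ = (((rows′ , cols′) , row0′) , col0′) , R≈ , weight
        where
        rows′ : ∀ k → IsPerm (R′ k)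
        rows′ k = perm-resp (λ i → sym (R′≈ k i)) (rows (inv ρ k))
        cols′ : ∀ i → IsPerm (λ k → R′ k i)
        cols′ i = perm-resp (λ k → sym (R′≈ k i)) (∘-perm (cols i) (inv-perm perm))
        row0′ : ∀ i → R′ zero i ≡ i
        row0′ i = trans (R′≈ zero i) (trans
          (cong (λ k → R k i) (trans (cong (inv ρ) (sym ρ0≡0)) (inv-left perm zero))) (row0 i))
        col0′ : ∀ k → R′ k zero ≡ k
        col0′ k = trans (R′≈ k zero) (trans (sym (first (inv ρ k))) (inv-right perm k))
        R≈ : ∀ k i → R k i ≡ R′ (ρ k) i
        R≈ k i = sym (trans (R′≈ (ρ k) i) (cong (λ l → R l i) (inv-left perm k)))
        weight : rowSigns R ≡ rowSigns R′
        weight = trans (∏-cong (λ k → sgn-cong (R≈ k))) (∏-reindex perm (λ k → sgn (R′ k)))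

      from : ∀ R R′ → Reduced R′ → (∀ k i → R k i ≡ R′ (ρ k) i) →
        ((∀ k → ρ k ≡ R k zero) × FirstRowId R) × (∀ k i → R′ k i ≡ R (inv ρ k) i)
      from R R′ (((rows′ , cols′) , row0′) , col0′) R≈ =
          ( (λ k → sym (trans (R≈ k zero) (col0′ (ρ k))))
          , ( (λ k → perm-resp (λ i → sym (R≈ k i)) (rows′ (ρ k)))
            , (λ i → perm-resp (λ k → sym (R≈ k i)) (∘-perm (cols′ i) perm)))
          , (λ i → trans (R≈ zero i) (trans (cong (λ k → R′ k i) ρ0≡0) (row0′ i))))
        , (λ k i → sym (trans (R≈ (inv ρ k) i) (cong (λ l → R′ l i) (inv-right perm k))))

    fibre : ∀ ρ → ∑ (allSquares (suc m)) (λ R → ⟦ ρ F.≈? (λ k → R k zero) ⟧ *ℤ (⟦ firstRowId? R ⟧ *ℤ rowSigns R)) ≡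
      ⟦ fixesZero? ρ ⟧ *ℤ S
    fibre ρ = byCases (fixesZero? ρ)
      where
      byCases : (d : Dec (IsPerm ρ × ρ zero ≡ zero)) →
        ∑ (allSquares (suc m)) (λ R → ⟦ ρ F.≈? (λ k → R k zero) ⟧ *ℤ (⟦ firstRowId? R ⟧ *ℤ rowSigns R)) ≡ ⟦ d ⟧ *ℤ S
      byCases (yes (perm , ρ0≡0)) = trans
        (∑-fibre-reindex (squares (suc m)) (squares (suc m)) (λ R → ρ F.≈? (λ k → R k zero)) firstRowId? reduced? rowSigns rowSigns
          (λ R k → R (inv ρ k)) (λ R k → R (ρ k)) (to ρ perm ρ0≡0) (from ρ perm ρ0≡0))
        (sym (ℤ.*-identityˡ S))
      byCases (no ¬fixes) = ∑-fibre-empty (allSquares (suc m)) (λ R → ρ F.≈? (λ k → R k zero)) firstRowId? rowSigns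
        (λ R first ((_ , cols) , row0) →
          ¬fixes (perm-resp (λ k → sym (first k)) (cols zero) , trans (first zero) (row0 zero)))

  -- Under the conjugation, the identity row `zero` of R puts symbol `zero` on the whole diagonal of
  -- L, and the identity column `zero` of R is the identity first row of L.
  ∑-symbol-conjugate :
    ∑ (allSquares (suc m)) (λ R → ⟦ reduced? R ⟧ *ℤ rowSigns R) ≡
    ∑ (allSquares (suc m)) (λ L → ⟦ normUnipLatin? L ⟧ *ℤ (Δ (suc m) *ℤ sgnSquare L))
  ∑-symbol-conjugate = ∑-reindex (squares (suc m)) (squares (suc m)) reduced? normUnipLatin? rowSigns
    (λ L → Δ (suc m) *ℤ sgnSquare L) (λ R i j → inv (λ k → R k i) j) (λ L k i → inv (L i) k) to from
    where
    to : ∀ R L → Reduced R → (∀ i j → L i j ≡ inv (λ k → R k i) j) →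
      NormUnipLatin L × (∀ k i → R k i ≡ inv (L i) k) × rowSigns R ≡ Δ (suc m) *ℤ sgnSquare L
    to R L (((rows , cols) , row0) , col0) L≈ = (latin , normalized , unipotent) , R≈ , symbolSign-sgnSquare
      where
      R-L : ∀ i j → R (L i j) i ≡ j
      R-L i j = trans (cong (λ k → R k i) (L≈ i j)) (inv-right (cols i) j)
      L-R : ∀ k i → L i (R k i) ≡ k
      L-R k i = cols i _ k (R-L i (R k i))
      latin : IsLatin L
      latin = (λ i j j′ e → trans (sym (R-L i j)) (trans (cong (λ k → R k i) e) (R-L i j′)))
            , (λ j i i′ e → rows (L i j) i i′ (trans (R-L i j) (sym (trans (cong (λ k → R k i′) e) (R-L i′ j)))))
      normalized : ∀ j → L zero j ≡ j
      normalized j = trans (sym (col0 (L zero j))) (R-L zero j)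
      diagonal : ∀ i → L i i ≡ zero
      diagonal i = cols i _ zero (trans (R-L i i) (sym (row0 i)))
      unipotent : IsUnipotent L
      unipotent i j = trans (diagonal i) (sym (diagonal j))
      R≈ : ∀ k i → R k i ≡ inv (L i) k
      R≈ k i = proj₁ latin i _ _ (trans (L-R k i) (sym (inv-right (proj₁ latin i) k)))
      open ThreeSigns L R latin L-R

    from : ∀ R L → NormUnipLatin L → (∀ k i → R k i ≡ inv (L i) k) →
      Reduced R × (∀ i j → L i j ≡ inv (λ k → R k i) j)
    from R L ((rows , cols) , normalized , unipotent) R≈ = (((rowsR , colsR) , row0) , col0) , L≈
      where
      L-R : ∀ k i → L i (R k i) ≡ k
      L-R k i = trans (cong (L i) (R≈ k i)) (inv-right (rows i) k)
      R-L : ∀ i j → R (L i j) i ≡ j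
      R-L i j = rows i _ j (L-R (L i j) i)
      rowsR : ∀ k → IsPerm (R k)
      rowsR k i i′ e = cols (R k i) i i′ (trans (L-R k i) (sym (trans (cong (L i′) e) (L-R k i′))))
      colsR : ∀ i → IsPerm (λ k → R k i)
      colsR i k k′ e = trans (sym (L-R k i)) (trans (cong (L i) e) (L-R k′ i))
      row0 : ∀ i → R zero i ≡ i
      -- Normalization makes `L zero zero` equal to `zero`, and unipotency spreads this symbol along
      -- the diagonal.
      row0 i = rows i _ i (trans (L-R zero i) (trans (sym (normalized zero)) (unipotent zero i)))
      col0 : ∀ k → R k zero ≡ k
      col0 k = trans (sym (normalized (R k zero))) (L-R k zero)
      L≈ : ∀ i j → L i j ≡ inv (λ k → R k i) j
      L≈ i j = colsR i _ _ (trans (R-L i j) (sym (inv-right (colsR i) j)))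

-- `AT n` as a signed sum

length-filter : ∀ {P : A → Set} (P? : ∀ x → Dec (P x)) xs → + length (filter P? xs) ≡ ∑ xs (λ x → ⟦ P? x ⟧)
length-filter P? []       = refl
length-filter P? (x ∷ xs) with P? x
... | yes _ = cong (1ℤ +ℤ_) (length-filter P? xs)
... | no _  = trans (length-filter P? xs) (sym (ℤ.+-identityˡ _))

sgnSquare-isSign : (L : Square n) → IsSign (sgnSquare L)
sgnSquare-isSign {n} L
  rewrite prodℤ-∏ n (λ i → sgn (row L i)) | prodℤ-∏ n (λ j → sgn (col L j)) =
  *-isSign (∏-isSign (λ i → sgn-isSign (row L i))) (∏-isSign (λ j → sgn-isSign (col L j)))

-- The sign of a square is always 1 or -1, so the even indicator minus the odd one is the sign
-- itself; `split` states this additively.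
AT-∑ : ∀ n → AT n ≡ ∑ (allSquares n) (λ L → ⟦ normUnipLatin? L ⟧ *ℤ sgnSquare L)
AT-∑ n = begin
  + UE n -ℤ + UO n   ≡⟨ cong₂ _-ℤ_ (length-filter even? (allSquares n)) (length-filter odd? (allSquares n)) ⟩
  E -ℤ O             ≡⟨ cong (_-ℤ O) (trans (∑-cong (allSquares n) (λ L → split (normUnipLatin? L) (sgnSquare-isSign L)))
                          (∑-distrib-+ (allSquares n) (λ L → ⟦ normUnipLatin? L ⟧ *ℤ sgnSquare L) (λ L → ⟦ odd? L ⟧))) ⟩
  (S +ℤ O) -ℤ O      ≡⟨ solve 2 (λ s o → (s :+ o) :- o := s) refl S O ⟩
  S                  ∎
  where
  even? : ∀ (L : Square n) → Dec (NormUnipLatin L × sgnSquare L ≡ 1ℤ)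
  even? L = normUnipLatin? L ×-dec (sgnSquare L ℤ.≟ 1ℤ)
  odd? : ∀ (L : Square n) → Dec (NormUnipLatin L × sgnSquare L ≡ -1ℤ)
  odd? L = normUnipLatin? L ×-dec (sgnSquare L ℤ.≟ -1ℤ)
  E O S : ℤ
  E = ∑ (allSquares n) (λ L → ⟦ even? L ⟧)
  O = ∑ (allSquares n) (λ L → ⟦ odd? L ⟧)
  S = ∑ (allSquares n) (λ L → ⟦ normUnipLatin? L ⟧ *ℤ sgnSquare L)
  split : ∀ {P : Set} (P? : Dec P) {s} → IsSign s →
    ⟦ P? ×-dec (s ℤ.≟ 1ℤ) ⟧ ≡ ⟦ P? ⟧ *ℤ s +ℤ ⟦ P? ×-dec (s ℤ.≟ -1ℤ) ⟧
  split (yes _) (inj₁ refl) = refl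
  split (yes _) (inj₂ refl) = refl
  split (no _)  (inj₁ refl) = refl
  split (no _)  (inj₂ refl) = refl

theorem4 : (n : ℕ) → n % 2 ≡ 1 →
    coeff (per n *P (det n ^P (n ∸ 1))) allOnes
    ≡ (+ ((n !) * ((n ∸ 1) !))) *ℤ ((-1ℤ ^ ((n * (n ∸ 1)) / 2)) *ℤ AT n)
-- Oddness rules out n = 0, so n ∸ 1 computes to m.
theorem4 (suc m) odd = begin
  coeff (per (suc m) *P (det (suc m) ^P m)) allOnes
    ≡⟨ coeff-Latin m ⟩
  ∑ Sq (λ R → ⟦ isLatin? R ⟧ *ℤ ∏ (λ k → sgn (R (suc k))))
    ≡⟨ ∑-normalize-row m odd ⟩
  + (suc m !) *ℤ ∑ Sq (λ R → ⟦ firstRowId? m R ⟧ *ℤ rowSigns R)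
    ≡⟨ cong (+ (suc m !) *ℤ_) (∑-normalize-column m) ⟩
  + (suc m !) *ℤ (+ (m !) *ℤ ∑ Sq (λ R → ⟦ reduced? m R ⟧ *ℤ rowSigns R))
    ≡⟨ sym (ℤ.*-assoc (+ (suc m !)) (+ (m !)) _) ⟩
  + (suc m !) *ℤ + (m !) *ℤ ∑ Sq (λ R → ⟦ reduced? m R ⟧ *ℤ rowSigns R)
    ≡⟨ cong₂ _*ℤ_ (sym (ℤ.pos-* (suc m !) (m !))) signed-count ⟩
  + ((suc m !) * (m !)) *ℤ ((-1ℤ ^ ((suc m * m) / 2)) *ℤ AT (suc m)) ∎
  where
  Sq = allSquares (suc m)
  signed-count : ∑ Sq (λ R → ⟦ reduced? m R ⟧ *ℤ rowSigns R) ≡ (-1ℤ ^ ((suc m * m) / 2)) *ℤ AT (suc m)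
  signed-count = begin
    ∑ Sq (λ R → ⟦ reduced? m R ⟧ *ℤ rowSigns R)
      ≡⟨ ∑-symbol-conjugate m ⟩
    ∑ Sq (λ L → ⟦ normUnipLatin? L ⟧ *ℤ (Δ (suc m) *ℤ sgnSquare L))
      ≡⟨ ∑-cong Sq (λ L → solve 3 (λ a b c → a :* (b :* c) := b :* (a :* c)) refl ⟦ normUnipLatin? L ⟧ (Δ (suc m)) (sgnSquare L)) ⟩
    ∑ Sq (λ L → Δ (suc m) *ℤ (⟦ normUnipLatin? L ⟧ *ℤ sgnSquare L))
      ≡⟨ sym (∑-distribˡ-* Sq (Δ (suc m)) (λ L → ⟦ normUnipLatin? L ⟧ *ℤ sgnSquare L)) ⟩
    Δ (suc m) *ℤ ∑ Sq (λ L → ⟦ normUnipLatin? L ⟧ *ℤ sgnSquare L)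
      ≡⟨ cong₂ _*ℤ_ (Δ-binomial (suc m)) (sym (AT-∑ (suc m))) ⟩
    (-1ℤ ^ ((suc m * m) / 2)) *ℤ AT (suc m) ∎
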